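{- Let $\theta\in\mathbb{R}$. There exists $M\in\mathbb{N}$ such that $(m+1)\,d_\theta(m)<1+\frac{2}{\sqrt5}$ for all integers $m\ge M$ if and only if $\theta\asymp\varphi$.
   Context: For $\theta\in\mathbb{R}$ and an integer $m\ge 0$, let $d_\theta(m)=\sup\{|I| : I\subset\mathbb{R}\text{ an interval},\ (I+\mathbb{Z})\cap\{0,\theta,2\theta,\dots,m\theta\}=\emptyset\}$, where $|I|$ is the length of $I$; this is the largest gap modulo 1 among the $m+1$ multiples $0,\theta,\dots,m\theta$. $\mathbb{N}$ is the set of positive integers. $\varphi=\frac{1+\sqrt5}{2}$ is the golden ratio, whose continued fraction is $[1,1,1,\dots]$. For two infinite (simple) continued fractions $\theta,\sigma$, $\theta\asymp\sigma$ means that there are positive integers $m,n$ such that the continued fraction expansions of $\theta$ and $\sigma$ agree after removing the prefixes of length $m$ and $n$, respectively. (A rational number has no infinite continued fraction and is not equivalent to $\varphi$.) -}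

module Defs where

open import Algebra.Apartness.Bundles using (HeytingField)
open import Algebra.Apartness.Structures using (IsHeytingField)
open import Algebra.Bundles using (CommutativeRing)
import Algebra.Definitions.RawMonoid as RawMonoidMult
import Algebra.Properties.Ring as RingProperties
import Algebra.Apartness.Properties.HeytingCommutativeRing as HeytingProperties
open import Data.Integer.Base as ℤ using (ℤ; +_; -[1+_]; 0ℤ)
open import Data.Nat.Base as ℕ using (ℕ; zero; suc)
open import Data.Product.Base using (Σ; ∃-syntax; _×_; _,_; proj₁; proj₂)
open import Data.Sum.Base using (_⊎_; inj₁; inj₂)
open import Level using (_⊔_; Level) renaming (suc to lsuc)
open import Relation.Binary.Core using (Rel)
open import Relation.Binary.PropositionalEquality.Core using (_≡_)
open import Relation.Binary.Structures using (IsStrictPartialOrder)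
open import Relation.Nullary.Negation using (¬_; contradiction)

-- The real numbers, given axiomatically as a Cauchy-complete Archimedean
-- ordered field.  Classically ℝ is the only one, up to isomorphism.  The
-- axioms are phrased constructively: instead of trichotomy the order satisfies
-- tightness and cotransitivity of x < y ⊎ y < x, which are part of
-- IsHeytingField.
record Reals c ℓ₁ ℓ₂ : Set (lsuc (c ⊔ ℓ₁ ⊔ ℓ₂)) where
  infix  8 -_
  infixl 7 _*_
  infixl 6 _+_
  infix  4 _≈_ _<_ _≤_
  field
    ℝ    : Set c
    _≈_  : Rel ℝ ℓ₁
    _<_  : Rel ℝ ℓ₂
    _+_  : ℝ → ℝ → ℝ
    _*_  : ℝ → ℝ → ℝ
    -_   : ℝ → ℝ
    0#   : ℝ
    1#   : ℝ
    isHeytingField       : IsHeytingField _≈_ (λ x y → x < y ⊎ y < x) _+_ _*_ -_ 0# 1#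
    isStrictPartialOrder : IsStrictPartialOrder _≈_ _<_
    +-monoʳ-<            : ∀ z {x y} → x < y → z + x < z + y
    *-positive           : ∀ {x y} → 0# < x → 0# < y → 0# < x * y

  heytingField : HeytingField c ℓ₁ ℓ₂
  heytingField = record { isHeytingField = isHeytingField }

  open HeytingField heytingField public
    using (heytingCommutativeRing; #⇒invertible; invertible⇒#; tight; _-_)

  open HeytingField heytingField using (isCommutativeRing)

  commutativeRing : CommutativeRing c ℓ₁
  commutativeRing = record { isCommutativeRing = isCommutativeRing }

  open RawMonoidMult (CommutativeRing.+-rawMonoid commutativeRing) public
    using () renaming (_×_ to _·_)

  _≤_ : Rel ℝ ℓ₂
  x ≤ y = ¬ (y < x)

  -- |x - y| < ε
  Within : ℝ → ℝ → ℝ → Set ℓ₂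
  Within ε x y = x < y + ε × y < x + ε

  IsCauchy : (ℕ → ℝ) → Set (c ⊔ ℓ₂)
  IsCauchy s = ∀ ε → 0# < ε →
    ∃[ N ] (∀ m n → N ℕ.≤ m → N ℕ.≤ n → Within ε (s m) (s n))

  ConvergesTo : (ℕ → ℝ) → ℝ → Set (c ⊔ ℓ₂)
  ConvergesTo s x = ∀ ε → 0# < ε → ∃[ N ] (∀ n → N ℕ.≤ n → Within ε (s n) x)

  field
    archimedean : ∀ x → ∃[ n ] x < n · 1#
    complete    : ∀ s → IsCauchy s → ∃[ x ] ConvergesTo s x

module RealTheory {c ℓ₁ ℓ₂} (R : Reals c ℓ₁ ℓ₂) where

  open Reals R public
  open IsStrictPartialOrder isStrictPartialOrder
    using (irrefl; <-respʳ-≈; <-respˡ-≈) renaming (trans to <-trans)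
  open CommutativeRing commutativeRing
    using (sym; trans; +-identityʳ; -‿inverseˡ; -‿inverseʳ;
           *-identityʳ; *-congˡ; *-congʳ; *-comm; ring)
    renaming (refl to ≈-refl)
  open RingProperties ring using (-‿distribʳ-*; -‿involutive)
  open HeytingProperties heytingCommutativeRing using (x-0≈x; 1#0)

  private
    neg⇒0<- : ∀ {x} → x < 0# → 0# < - x
    neg⇒0<- {x} x<0 =
      <-respˡ-≈ (-‿inverseˡ x) (<-respʳ-≈ (+-identityʳ (- x)) (+-monoʳ-< (- x) x<0))

  0<1 : 0# < 1#
  0<1 with 1#0
  ... | inj₂ 0<1 = 0<1
  ... | inj₁ 1<0 = contradiction (<-trans 1<0 0<[-1]²) (irrefl ≈-refl)
    where
    [-1]²≈1 : (- 1#) * (- 1#) ≈ 1#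
    [-1]²≈1 = trans (sym (-‿distribʳ-* (- 1#) 1#))
                (trans (CommutativeRing.-‿cong commutativeRing (*-identityʳ (- 1#)))
                       (-‿involutive 1#))
    0<[-1]² : 0# < 1#
    0<[-1]² = <-respʳ-≈ [-1]²≈1 (*-positive (neg⇒0<- 1<0) (neg⇒0<- 1<0))

  +-positive : ∀ {x y} → 0# < x → 0# < y → 0# < x + y
  +-positive {x} 0<x 0<y = <-trans 0<x (<-respˡ-≈ (+-identityʳ x) (+-monoʳ-< x 0<y))

  0<suc : ∀ n → 0# < suc n · 1#
  0<suc zero    = <-respʳ-≈ (sym (+-identityʳ 1#)) 0<1
  0<suc (suc n) = +-positive 0<1 (0<suc n)

  inv : ∀ x → 0# < x → ℝ
  inv x 0<x = proj₁ (#⇒invertible (inj₂ 0<x))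

  x*inv≈1 : ∀ x (0<x : 0# < x) → x * inv x 0<x ≈ 1#
  x*inv≈1 x 0<x = trans (*-congʳ (sym (x-0≈x x))) (proj₂ (proj₂ (#⇒invertible (inj₂ 0<x))))

  inv-positive : ∀ x (0<x : 0# < x) → 0# < inv x 0<x
  inv-positive x 0<x with invertible⇒# {inv x 0<x} {0#}
    (x , trans (*-congˡ (x-0≈x _)) (x*inv≈1 x 0<x)
       , trans (*-comm _ x) (trans (*-congˡ (x-0≈x _)) (x*inv≈1 x 0<x)))
  ... | inj₂ 0<i = 0<i
  ... | inj₁ i<0 = contradiction (<-trans 0<1 1<0) (irrefl ≈-refl)
    where
    0<-1 : 0# < - 1#
    0<-1 = <-respʳ-≈
      (trans (sym (-‿distribʳ-* x _)) (CommutativeRing.-‿cong commutativeRing (x*inv≈1 x 0<x)))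
      (*-positive 0<x (neg⇒0<- i<0))
    1<0 : 1# < 0#
    1<0 = <-respˡ-≈ (+-identityʳ 1#) (<-respʳ-≈ (-‿inverseʳ 1#) (+-monoʳ-< 1# 0<-1))

  fromℤ : ℤ → ℝ
  fromℤ (+ n)    = n · 1#
  fromℤ -[1+ n ] = - (suc n · 1#)

  0<fromℤ : ∀ {z} → 0ℤ ℤ.< z → 0# < fromℤ z
  0<fromℤ {+ suc n} _ = 0<suc n
  0<fromℤ {+ zero} (ℤ.+<+ ())

  IsUpperBound : ∀ {ℓ} → (ℝ → Set ℓ) → ℝ → Set (c ⊔ ℓ₂ ⊔ ℓ)
  IsUpperBound S u = ∀ x → S x → x ≤ u

  IsSupremum : ∀ {ℓ} → (ℝ → Set ℓ) → ℝ → Set (c ⊔ ℓ₂ ⊔ ℓ)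
  IsSupremum S d = IsUpperBound S d × (∀ u → IsUpperBound S u → d ≤ u)

  data Endpoint : Set where
    included excluded : Endpoint

  -- Bounded intervals of all four kinds.  Unbounded ones are omitted: their
  -- integer translates cover ℝ, so they never avoid the multiples of θ below.
  record Interval : Set (c ⊔ ℓ₂) where
    field
      left right        : ℝ
      left≤right        : left ≤ right
      leftEnd  rightEnd : Endpoint

  Precedes : Endpoint → Rel ℝ ℓ₂
  Precedes included = _≤_
  Precedes excluded = _<_

  infix 4 _∈_
  _∈_ : ℝ → Interval → Set ℓ₂
  x ∈ I = Precedes leftEnd left x × Precedes rightEnd x right
    where open Interval I

  length : Interval → ℝ
  length I = right - left
    where open Interval I

  -- (I + ℤ) ∩ {0, θ, …, mθ} = ∅
  Avoids : Interval → ℝ → ℕ → Set (c ⊔ ℓ₁ ⊔ ℓ₂)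
  Avoids I θ m = ∀ {x} → x ∈ I → ∀ z k → k ℕ.≤ m → ¬ (x + fromℤ z ≈ k · θ)

  -- d = d_θ(m).  A relation, because suprema need not exist constructively.
  IsLargestGap : ℝ → ℕ → ℝ → Set (c ⊔ ℓ₁ ⊔ ℓ₂)
  IsLargestGap θ m = IsSupremum (λ x → Σ Interval λ I → Avoids I θ m × x ≈ length I)

  record ContinuedFraction : Set where
    field
      quotient : ℕ → ℤ
      positive : ∀ i → 0ℤ ℤ.< quotient (suc i)

  module _ (a : ContinuedFraction) where
    open ContinuedFraction a

    -- [aᵢ₊₁; aᵢ₊₂, …, aᵢ₊₁₊ₙ], which is positive
    segment : ℕ → ℕ → Σ ℝ (0# <_)
    segment i zero    = fromℤ (quotient (suc i)) , 0<fromℤ (positive i)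
    segment i (suc n) =
      fromℤ (quotient (suc i)) + inv (proj₁ rest) (proj₂ rest) ,
      +-positive (0<fromℤ (positive i)) (inv-positive (proj₁ rest) (proj₂ rest))
      where rest = segment (suc i) n

    -- [a₀; a₁, …, aₙ]
    convergent : ℕ → ℝ
    convergent zero    = fromℤ (quotient 0)
    convergent (suc n) = fromℤ (quotient 0) + inv (proj₁ (segment 0 n)) (proj₂ (segment 0 n))

  -- x = [a₀; a₁, a₂, …]
  _HasExpansion_ : ℝ → ContinuedFraction → Set (c ⊔ ℓ₂)
  x HasExpansion a = ConvergesTo (convergent a) x

  infix 4 _≍_
  _≍_ : Rel ℝ (c ⊔ ℓ₂)
  x ≍ y = ∃[ a ] ∃[ b ] x HasExpansion a × y HasExpansion b ×
    ∃[ m ] ∃[ n ] 0 ℕ.< m × 0 ℕ.< n ×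
      (∀ i → ContinuedFraction.quotient a (m ℕ.+ i) ≡ ContinuedFraction.quotient b (n ℕ.+ i))

  goldenRatio : ℝ → ℝ
  goldenRatio √5 = (1# + √5) * inv (2 · 1#) (0<suc 1)

{-# OPTIONS --safe #-}
module Submission where

-- Let p′/q′, p/q be consecutive convergents of θ and u = |q′θ - p′|, v = |qθ - p|,
-- so that qu + q′v = 1.  The points (q - 1)θ and (q - 1 + q′)θ stay neighbours up
-- to index 2q + q′ - 2, which gives a gap u.  If 2v < u, i.e. the next partial
-- quotient is at least 2, then (2q + q′ - 1) u ≥ 2 - u, which exceeds 1 + 2/√5 for
-- large q; hence small gaps force all late partial quotients to be 1.  Conversely,
-- if those are all 1, then u is the largest gap for every index from q + q′ - 1
-- to 2q + q′ - 2, u = φv exactly, and (2q + q′ - 1) u < 1 + 2/√5 amounts to an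
-- upper bound on q - φq′, which tends to 0 because q² - qq′ - q′² is constant
-- up to sign.

open import Defs
open import Algebra.Apartness.Bundles using (HeytingField)
open import Algebra.Bundles using (CommutativeRing)
import Algebra.Properties.Monoid.Mult as MonoidMult
import Algebra.Properties.Ring as RingProperties
import Algebra.Properties.Semiring.Mult as SemiringMult
import Algebra.Solver.Ring as RingSolver
open import Algebra.Solver.Ring.AlmostCommutativeRing
  using (fromCommutativeRing; _-Raw-AlmostCommutative⟶_)
open import Data.Empty using (⊥)
open import Data.Integer.Base as ℤ using (ℤ; +_; -[1+_]; 0ℤ; 1ℤ; +[1+_])
import Data.Integer.Properties as ℤₚ
open import Data.Integer.Solver using (module +-*-Solver)
open import Data.Maybe.Base as Maybe using (Maybe)
open import Data.Nat.Base as ℕ using (ℕ; zero; suc; z≤n; s≤s)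
import Data.Nat.Properties as ℕₚ
open import Data.Product.Base using (Σ; ∃-syntax; _×_; _,_; proj₁; proj₂)
open import Data.Sum.Base as Sum using (_⊎_; inj₁; inj₂)
open import Function.Bundles using (_⇔_; mk⇔)
import Level
open import Relation.Binary.PropositionalEquality as ≡ using (_≡_)
open import Relation.Binary.Structures using (IsStrictPartialOrder)
open import Relation.Nullary.Decidable.Core using (yes; no; dec⇒maybe)
open import Relation.Nullary.Negation using (¬_; contradiction)

-- The constant is a limit: for `q = φ q′` and `u = φ v` the ratio of `(2q + q′) u` to
-- `q u + q′ v = 1` is `(2φ + 1) φ / (φ² + 1) = (2φ + 1) / √5 = 1 + 2/√5`. Along a golden tail the
-- products at the ends of the index ranges approach it, so strictness must come from the
-- lower-order term `- u` in `(2q + q′ - 1) u`, which has to outweigh the error due to `q - φ q′`.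
-- The other obstacle is constructive. In one direction the supremum is exhibited, namely `u`. In
-- the other, small gaps must first yield a decision whether `qθ - p` is positive or negative: if it
-- were too close to 0, the multiples of θ would cluster like those of a rational number and leave a
-- gap of length `1/(2q)` at an index `m ≥ 4q`. These sign decisions make the floors of the
-- Euclidean algorithm computable, and the expansion so produced is then shown to converge to θ.

module OrderedField {c ℓ₁ ℓ₂} (R : Reals c ℓ₁ ℓ₂) where

  open RealTheory R
  open CommutativeRing commutativeRing public
    using (refl; sym; trans; +-cong; +-congˡ; +-congʳ; *-cong; *-congˡ; *-congʳ; -‿cong;
           +-identityʳ; +-identityˡ; -‿inverseʳ; -‿inverseˡ; *-comm; +-comm; *-identityˡ; *-identityʳ)
  open CommutativeRing commutativeRing using (ring; +-monoid; semiring)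
  open RingProperties ring using (-‿distribʳ-*; -‿distribˡ-*; -‿involutive; -0#≈0#; -‿+-comm)
  open MonoidMult +-monoid using (×-homo-+)
  open SemiringMult semiring using (×1-homo-*; ×-assoc-*)
  open IsStrictPartialOrder isStrictPartialOrder public
    using (irrefl; <-respʳ-≈; <-respˡ-≈) renaming (trans to <-trans)
  open HeytingField heytingField using (#-cotrans)

  -- Integers

  ⌜_⌝ : ℕ → ℝ
  ⌜ n ⌝ = n · 1#

  ⌜⌝-+ : ∀ m n → ⌜ m ℕ.+ n ⌝ ≈ ⌜ m ⌝ + ⌜ n ⌝
  ⌜⌝-+ = ×-homo-+ 1#

  ⌜⌝-* : ∀ m n → ⌜ m ℕ.* n ⌝ ≈ ⌜ m ⌝ * ⌜ n ⌝
  ⌜⌝-* = ×1-homo-*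

  ·≈* : ∀ n x → n · x ≈ ⌜ n ⌝ * x
  ·≈* n x = sym (trans (×-assoc-* n 1# x) (MonoidMult.×-congʳ +-monoid n (*-identityˡ x)))

  fromℤ-neg : ∀ i → fromℤ (ℤ.- i) ≈ - fromℤ i
  fromℤ-neg (+ zero)  = sym -0#≈0#
  fromℤ-neg +[1+ n ]  = refl
  fromℤ-neg -[1+ n ]  = sym (-‿involutive _)

  private
    [1+a]-[1+b] : ∀ a b → (1# + a) + - (1# + b) ≈ a + - b
    [1+a]-[1+b] a b = trans (+-congˡ (sym (-‿+-comm 1# b)))
      (trans (+-assoc 1# a _) (trans (+-congˡ (trans (+-congˡ (+-comm _ _)) (sym (+-assoc a _ _))))
      (trans (+-comm _ _) (trans (+-assoc _ _ _) (trans (+-congˡ (-‿inverseˡ 1#)) (+-identityʳ _))))))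
      where open CommutativeRing commutativeRing using (+-assoc)

    fromℤ-⊖ : ∀ m n → fromℤ (m ℤ.⊖ n) ≈ ⌜ m ⌝ + - ⌜ n ⌝
    fromℤ-⊖ zero zero = sym (-‿inverseʳ 0#)
    fromℤ-⊖ zero (suc n) = sym (+-identityˡ _)
    fromℤ-⊖ (suc m) zero = sym (trans (+-congˡ -0#≈0#) (+-identityʳ _))
    fromℤ-⊖ (suc m) (suc n) rewrite ℤₚ.[1+m]⊖[1+n]≡m⊖n m n =
      trans (fromℤ-⊖ m n) (sym ([1+a]-[1+b] ⌜ m ⌝ ⌜ n ⌝))

  fromℤ-+ : ∀ i j → fromℤ (i ℤ.+ j) ≈ fromℤ i + fromℤ j
  fromℤ-+ (+ m)    (+ n)    = ⌜⌝-+ m n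
  fromℤ-+ (+ m)    -[1+ n ] = fromℤ-⊖ m (suc n)
  fromℤ-+ -[1+ m ] (+ n)    = trans (fromℤ-⊖ n (suc m)) (+-comm _ _)
  fromℤ-+ -[1+ m ] -[1+ n ] = trans
    (-‿cong (trans (+-congˡ (⌜⌝-+ (suc m) n))
      (trans (+-comm _ _) (trans (+-assoc _ _ _) (+-congˡ (+-comm _ _))))))
    (sym (-‿+-comm _ _))
    where open CommutativeRing commutativeRing using (+-assoc)

  private
    fromℤ-*⁺ : ∀ i n → fromℤ (i ℤ.* + n) ≈ fromℤ i * ⌜ n ⌝
    fromℤ-*⁺ (+ m) n rewrite ≡.sym (ℤₚ.pos-* m n) = ⌜⌝-* m n
    fromℤ-*⁺ -[1+ m ] n rewrite ≡.sym (ℤₚ.neg-distribˡ-* +[1+ m ] (+ n)) | ≡.sym (ℤₚ.pos-* (suc m) n) =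
      trans (fromℤ-neg (+ (suc m ℕ.* n))) (trans (-‿cong (⌜⌝-* (suc m) n)) (-‿distribˡ-* _ _))

  fromℤ-* : ∀ i j → fromℤ (i ℤ.* j) ≈ fromℤ i * fromℤ j
  fromℤ-* i (+ n) = fromℤ-*⁺ i n
  fromℤ-* i -[1+ n ] rewrite ≡.sym (ℤₚ.neg-distribʳ-* i +[1+ n ]) =
      trans (fromℤ-neg (i ℤ.* +[1+ n ])) (trans (-‿cong (fromℤ-*⁺ i (suc n))) (-‿distribʳ-* _ _))

  -- Agrees with fromℤ, but sends 1 to 1# itself, which fromℤ does only up to ≈.
  numeral : ℤ → ℝ
  numeral (+ 1) = 1#
  numeral i     = fromℤ i

  numeral≈fromℤ : ∀ i → numeral i ≈ fromℤ i
  numeral≈fromℤ (+ 0)           = refl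
  numeral≈fromℤ (+ 1)           = sym (+-identityʳ 1#)
  numeral≈fromℤ (+ suc (suc n)) = refl
  numeral≈fromℤ -[1+ n ]        = refl

  private
    coefficients : ℤ.+-*-rawRing -Raw-AlmostCommutative⟶ fromCommutativeRing commutativeRing
    coefficients = record
      { ⟦_⟧    = numeral
      ; +-homo = λ i j → trans (numeral≈fromℤ (i ℤ.+ j)) (trans (fromℤ-+ i j)
                   (sym (+-cong (numeral≈fromℤ i) (numeral≈fromℤ j))))
      ; *-homo = λ i j → trans (numeral≈fromℤ (i ℤ.* j)) (trans (fromℤ-* i j)
                   (sym (*-cong (numeral≈fromℤ i) (numeral≈fromℤ j))))
      ; -‿homo = λ i → trans (numeral≈fromℤ (ℤ.- i)) (trans (fromℤ-neg i)
                   (sym (-‿cong (numeral≈fromℤ i))))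
      ; 0-homo = refl
      ; 1-homo = refl
      }

    equal-numerals? : ∀ i j → Maybe (numeral i ≈ numeral j)
    equal-numerals? i j = Maybe.map (λ { ≡.refl → refl }) (dec⇒maybe (i ℤₚ.≟ j))

  open RingSolver ℤ.+-*-rawRing (fromCommutativeRing commutativeRing) coefficients
    equal-numerals? public using (solve; con; _:+_; _:*_; _:-_; :-_; _:=_)

  -- Order

  <-irrefl : ∀ {x} → ¬ (x < x)
  <-irrefl = irrefl refl

  <-cotrans : ∀ {x y} → x < y → ∀ z → x < z ⊎ z < y
  <-cotrans x<y z with #-cotrans (inj₁ x<y) z
  ... | inj₁ (inj₁ x<z) = inj₁ x<z
  ... | inj₁ (inj₂ z<x) = inj₂ (<-trans z<x x<y)
  ... | inj₂ (inj₁ z<y) = inj₂ z<y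
  ... | inj₂ (inj₂ y<z) = inj₁ (<-trans x<y y<z)

  <⇒≤ : ∀ {x y} → x < y → x ≤ y
  <⇒≤ x<y y<x = <-irrefl (<-trans x<y y<x)

  ≈⇒≤ : ∀ {x y} → x ≈ y → x ≤ y
  ≈⇒≤ x≈y y<x = <-irrefl (<-respˡ-≈ (sym x≈y) y<x)

  <-≤-trans : ∀ {x y z} → x < y → y ≤ z → x < z
  <-≤-trans {z = z} x<y y≤z with <-cotrans x<y z
  ... | inj₁ x<z = x<z
  ... | inj₂ z<y = contradiction z<y y≤z

  ≤-<-trans : ∀ {x y z} → x ≤ y → y < z → x < z
  ≤-<-trans {x} x≤y y<z with <-cotrans y<z x
  ... | inj₁ y<x = contradiction y<x x≤y
  ... | inj₂ x<z = x<z

  ≤-trans : ∀ {x y z} → x ≤ y → y ≤ z → x ≤ z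
  ≤-trans x≤y y≤z z<x = x≤y (≤-<-trans y≤z z<x)

  ≤-antisym : ∀ {x y} → x ≤ y → y ≤ x → x ≈ y
  ≤-antisym {x} {y} x≤y y≤x = proj₁ (tight x y) λ { (inj₁ x<y) → y≤x x<y ; (inj₂ y<x) → x≤y y<x }

  ≤-respˡ : ∀ {x y z} → x ≈ y → x ≤ z → y ≤ z
  ≤-respˡ x≈y x≤z z<y = x≤z (<-respʳ-≈ (sym x≈y) z<y)

  ≤-respʳ : ∀ {x y z} → x ≈ y → z ≤ x → z ≤ y
  ≤-respʳ x≈y z≤x y<z = z≤x (<-respˡ-≈ (sym x≈y) y<z)

  -- Inequalities are proved by exhibiting the difference as a positive quantity.
  by-pos : ∀ {x y d} → 0# < d → y - x ≈ d → x < y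
  by-pos {x} {y} 0<d e = <-respˡ-≈ (+-identityʳ x)
    (<-respʳ-≈ (trans (+-congˡ (sym e)) (solve 2 (λ x y → x :+ (y :- x) := y) refl x y)) (+-monoʳ-< x 0<d))

  pos : ∀ {x y} → x < y → 0# < y - x
  pos {x} {y} x<y = <-respˡ-≈ (-‿inverseˡ x) (<-respʳ-≈ (+-comm (- x) y) (+-monoʳ-< (- x) x<y))

  by-nonneg : ∀ {x y d} → 0# ≤ d → y - x ≈ d → x ≤ y
  by-nonneg {x} {y} {d} 0≤d e y<x = 0≤d (by-pos (pos y<x)
    (trans (+-congˡ (-‿cong (sym e))) (solve 2 (λ x y → con 0ℤ :- (y :- x) := x :- y) refl x y)))

  nonneg : ∀ {x y} → x ≤ y → 0# ≤ y - x
  nonneg {x} {y} x≤y <0 = x≤y (by-pos (pos <0) (solve 2 (λ x y → x :- y := con 0ℤ :- (y :- x)) refl x y))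

  +-nonneg-pos : ∀ {x y} → 0# ≤ x → 0# < y → 0# < x + y
  +-nonneg-pos {x} {y} 0≤x 0<y = ≤-<-trans 0≤x (by-pos 0<y (solve 2 (λ x y → x :+ y :- x := y) refl x y))

  +-pos-nonneg : ∀ {x y} → 0# < x → 0# ≤ y → 0# < x + y
  +-pos-nonneg 0<x 0≤y = <-respʳ-≈ (+-comm _ _) (+-nonneg-pos 0≤y 0<x)

  +-nonneg : ∀ {x y} → 0# ≤ x → 0# ≤ y → 0# ≤ x + y
  +-nonneg {x} {y} 0≤x 0≤y = ≤-trans 0≤x (by-nonneg 0≤y (solve 2 (λ x y → x :+ y :- x := y) refl x y))

  -- A factor of a positive product is invertible, hence apart from 0.
  *-pos⇒#0 : ∀ {x y} → 0# < x * y → 0# < x ⊎ x < 0#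
  *-pos⇒#0 {x} {y} 0<xy with invertible⇒# {x} {0#}
    (inv (x * y) 0<xy * y
    , trans (solve 3 (λ i x y → i :* y :* (x :- con 0ℤ) := x :* y :* i) refl _ x y) (x*inv≈1 _ 0<xy)
    , trans (solve 3 (λ i x y → (x :- con 0ℤ) :* (i :* y) := x :* y :* i) refl _ x y) (x*inv≈1 _ 0<xy))
  ... | inj₁ x<0 = inj₂ x<0
  ... | inj₂ 0<x = inj₁ 0<x

  *-cancelˡ-pos : ∀ {x y} → 0# ≤ x → 0# < x * y → 0# < y
  *-cancelˡ-pos {x} {y} 0≤x 0<xy with *-pos⇒#0 0<xy | *-pos⇒#0 (<-respʳ-≈ (*-comm x y) 0<xy)
  ... | inj₂ x<0 | _        = contradiction x<0 0≤x
  ... | inj₁ _   | inj₁ 0<y = 0<y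
  ... | inj₁ 0<x | inj₂ y<0 = contradiction (+-positive 0<xy (*-positive 0<x (pos y<0)))
    (≈⇒≤ (solve 2 (λ x y → x :* y :+ x :* (con 0ℤ :- y) := con 0ℤ) refl x y))

  *-nonneg : ∀ {x y} → 0# ≤ x → 0# ≤ y → 0# ≤ x * y
  *-nonneg {x} {y} 0≤x 0≤y xy<0 = contradiction
    (*-cancelˡ-pos 0≤x (<-respʳ-≈ (solve 2 (λ x y → con 0ℤ :- x :* y := x :* (:- y)) refl x y) (pos xy<0)))
    λ 0<-y → 0≤y (by-pos 0<-y (solve 1 (λ y → con 0ℤ :- y := :- y) refl y))

  *-monoˡ-≤ : ∀ {x y z} → 0# ≤ z → x ≤ y → z * x ≤ z * y
  *-monoˡ-≤ {x} {y} {z} 0≤z x≤y = by-nonneg (*-nonneg 0≤z (nonneg x≤y))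
    (solve 3 (λ x y z → z :* y :- z :* x := z :* (y :- x)) refl x y z)

  *-monoˡ-< : ∀ {x y z} → 0# < z → x < y → z * x < z * y
  *-monoˡ-< {x} {y} {z} 0<z x<y = by-pos (*-positive 0<z (pos x<y))
    (solve 3 (λ x y z → z :* y :- z :* x := z :* (y :- x)) refl x y z)

  *-cancelˡ-< : ∀ {x y z} → 0# ≤ z → z * x < z * y → x < y
  *-cancelˡ-< {x} {y} {z} 0≤z zx<zy = by-pos (*-cancelˡ-pos 0≤z
    (<-respʳ-≈ (solve 3 (λ x y z → z :* y :- z :* x := z :* (y :- x)) refl x y z) (pos zx<zy))) refl

  *-cancelˡ-≤ : ∀ {x y z} → 0# < z → z * x ≤ z * y → x ≤ y
  *-cancelˡ-≤ 0<z zx≤zy y<x = zx≤zy (*-monoˡ-< 0<z y<x)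

  *-cancelˡ-≈ : ∀ {x y z} → 0# < z → z * x ≈ z * y → x ≈ y
  *-cancelˡ-≈ 0<z zx≈zy = ≤-antisym (*-cancelˡ-≤ 0<z (≈⇒≤ zx≈zy)) (*-cancelˡ-≤ 0<z (≈⇒≤ (sym zx≈zy)))

  <-neg : ∀ {x y} → x < y → - y < - x
  <-neg {x} {y} x<y = by-pos (pos x<y) (solve 2 (λ x y → :- x :- :- y := y :- x) refl x y)

  ≤-neg : ∀ {x y} → x ≤ y → - y ≤ - x
  ≤-neg {x} {y} x≤y = by-nonneg (nonneg x≤y) (solve 2 (λ x y → :- x :- :- y := y :- x) refl x y)

  +-mono-≤ : ∀ {x y z w} → x ≤ y → z ≤ w → x + z ≤ y + w
  +-mono-≤ {x} {y} {z} {w} x≤y z≤w = by-nonneg (+-nonneg (nonneg x≤y) (nonneg z≤w))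
    (solve 4 (λ x y z w → y :+ w :- (x :+ z) := y :- x :+ (w :- z)) refl x y z w)

  +-mono-<-≤ : ∀ {x y z w} → x < y → z ≤ w → x + z < y + w
  +-mono-<-≤ {x} {y} {z} {w} x<y z≤w = by-pos (+-pos-nonneg (pos x<y) (nonneg z≤w))
    (solve 4 (λ x y z w → y :+ w :- (x :+ z) := y :- x :+ (w :- z)) refl x y z w)

  ⌜⌝-nonneg : ∀ n → 0# ≤ ⌜ n ⌝
  ⌜⌝-nonneg zero    = <-irrefl
  ⌜⌝-nonneg (suc n) = <⇒≤ (0<suc n)

  fromℤ-cancel-< : ∀ {i j} → fromℤ i < fromℤ j → i ℤ.< j
  fromℤ-cancel-< {i} {j} i<j with i ℤₚ.<? j
  ... | yes p = p
  ... | no ¬p = contradiction (pos i<j) (≤-respˡ (trans (fromℤ-+ j (ℤ.- i)) (+-congˡ (fromℤ-neg i)))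
                  (nonpos (j ℤ.- i) (ℤₚ.i≤j⇒i-j≤0 (ℤₚ.≮⇒≥ ¬p))) )
    where
    nonpos : ∀ k → k ℤ.≤ 0ℤ → fromℤ k ≤ 0#
    nonpos (+ zero) _ = <-irrefl
    nonpos -[1+ n ] _ = <⇒≤ (by-pos (0<suc n) (solve 1 (λ x → con 0ℤ :- :- x := x) refl _))
    nonpos +[1+ n ] (ℤ.+≤+ ())

  fromℤ-mono-≤ : ∀ {i j} → i ℤ.≤ j → fromℤ i ≤ fromℤ j
  fromℤ-mono-≤ i≤j j<i = ℤₚ.<⇒≱ (fromℤ-cancel-< j<i) i≤j

  fromℤ-≡ : ∀ {i j} → i ≡ j → fromℤ i ≈ fromℤ j
  fromℤ-≡ ≡.refl = refl

  ⌜⌝-mono-≤ : ∀ {m n} → m ℕ.≤ n → ⌜ m ⌝ ≤ ⌜ n ⌝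
  ⌜⌝-mono-≤ m≤n = fromℤ-mono-≤ (ℤ.+≤+ m≤n)

  inv*x≈1 : ∀ x (0<x : 0# < x) → inv x 0<x * x ≈ 1#
  inv*x≈1 x 0<x = trans (*-comm _ x) (x*inv≈1 x 0<x)

  inv-unique : ∀ {x y} (0<x : 0# < x) → x * y ≈ 1# → y ≈ inv x 0<x
  inv-unique {x} {y} 0<x xy≈1 = *-cancelˡ-≈ 0<x (trans xy≈1 (sym (x*inv≈1 x 0<x)))

  inv-cong : ∀ {x y} (0<x : 0# < x) (0<y : 0# < y) → x ≈ y → inv x 0<x ≈ inv y 0<y
  inv-cong {x} 0<x 0<y x≈y = inv-unique 0<y (trans (*-congʳ (sym x≈y)) (x*inv≈1 x 0<x))

  x<1+x : ∀ x → x < 1# + x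
  x<1+x x = by-pos 0<1 (solve 1 (λ x → con 1ℤ :+ x :- x := con 1ℤ) refl x)

  exceed : ∀ x {y} → 0# < y → ∃[ n ] x < ⌜ n ⌝ * y
  exceed x {y} 0<y with archimedean (x * inv y 0<y)
  ... | n , x/y<n = n , <-respˡ-≈ eq (<-respʳ-≈ (*-comm y ⌜ n ⌝) (*-monoˡ-< 0<y x/y<n))
    where
    eq : y * (x * inv y 0<y) ≈ x
    eq = trans (solve 3 (λ x y i → y :* (x :* i) := x :* (y :* i)) refl x y _)
           (trans (*-congˡ (x*inv≈1 y 0<y)) (*-identityʳ x))

  -- Comparison with integers cannot be decided for a general real, so the decisions are passed in;
  -- irrationality will supply them. The search descends from an Archimedean bound, and at 0 the
  -- positivity of `x` takes over.
  floor : ∀ {x} → 0# < x → (∀ k → x < ⌜ suc k ⌝ ⊎ ⌜ suc k ⌝ < x) →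
          ∃[ k ] ⌜ k ⌝ < x × x < 1# + ⌜ k ⌝
  floor {x} 0<x compare = let n , x<n = archimedean x in
      search n (<-trans x<n (x<1+x ⌜ n ⌝))
    where
    search : ∀ n → x < ⌜ suc n ⌝ → ∃[ k ] ⌜ k ⌝ < x × x < 1# + ⌜ k ⌝
    search zero    x<1 = 0 , 0<x , x<1
    search (suc n) x<  with compare n
    ... | inj₁ x<n = search n x<n
    ... | inj₂ n<x = suc n , n<x , x<

-- Gaps between the multiples of θ modulo 1

module Gaps {c ℓ₁ ℓ₂} (R : Reals c ℓ₁ ℓ₂) where

  open RealTheory R
  open OrderedField R

  -- Cramer's rule: when `q′p - qp′ = 1`, the lattice point `(j, z)` is `A (q′, p′) + B (q, p)` with
  -- `A = jp - zq` and `B = zq′ - jp′`, whence `jt - z = A u - B v`.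
  coordinates : ∀ j z p p' q q' t →
    (j * p - z * q) * (q' * t - p') - (z * q' - j * p') * (p - q * t) ≈ (j * t - z) * (q' * p - q * p')
  coordinates = solve 7 (λ j z p p' q q' t →
    (j :* p :- z :* q) :* (q' :* t :- p') :- (z :* q' :- j :* p') :* (p :- q :* t)
      := (j :* t :- z) :* (q' :* p :- q :* p')) refl

  -- The form of all the linear arithmetic below: contradictory inequalities are combined into a sum
  -- of nonnegative terms, one of them positive, which the ring solver then reduces to 0.
  absurd : ∀ {e} {a} {A : Set a} → 0# < e → e ≈ 0# → A
  absurd 0<e e≈0 = contradiction 0<e (≈⇒≤ e≈0)

  diff≈0 : ∀ {x y} → x ≈ y → x - y ≈ 0#
  diff≈0 {x} {y} x≈y = trans (+-congʳ x≈y) (-‿inverseʳ y)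

  fromℤ-minus : ∀ i j → fromℤ (i ℤ.- j) ≈ fromℤ i - fromℤ j
  fromℤ-minus i j = trans (fromℤ-+ i (ℤ.- j)) (+-congˡ (fromℤ-neg j))

  fromℤ-det : ∀ a b c d → fromℤ (a ℤ.* b ℤ.- c ℤ.* d) ≈ fromℤ a * fromℤ b - fromℤ c * fromℤ d
  fromℤ-det a b c d = trans (fromℤ-minus (a ℤ.* b) (c ℤ.* d))
    (+-cong (fromℤ-* a b) (-‿cong (fromℤ-* c d)))

  fromℤ≤0⊎1≤ : ∀ i → fromℤ i ≤ 0# ⊎ 1# ≤ fromℤ i
  fromℤ≤0⊎1≤ i with i ℤₚ.≤? 0ℤ
  ... | yes i≤0 = inj₁ (fromℤ-mono-≤ i≤0)
  ... | no  i≰0 = inj₂ (≤-respˡ (+-identityʳ 1#) (fromℤ-mono-≤ (ℤₚ.i<j⇒suc[i]≤j (ℤₚ.≰⇒> i≰0))))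

  0≤fromℤ⊎≤-1 : ∀ i → 0# ≤ fromℤ i ⊎ fromℤ i ≤ - 1#
  0≤fromℤ⊎≤-1 i with fromℤ≤0⊎1≤ (ℤ.- i)
  ... | inj₁ -i≤0 = inj₁ (by-nonneg (nonneg (≤-respˡ (fromℤ-neg i) -i≤0))
                      (solve 1 (λ i → i :- con 0ℤ := con 0ℤ :- :- i) refl _))
  ... | inj₂ 1≤-i = inj₂ (by-nonneg (nonneg (≤-respʳ (fromℤ-neg i) 1≤-i))
                      (solve 1 (λ i → :- con 1ℤ :- i := :- i :- con 1ℤ) refl _))

  Gap : ℝ → ℕ → ℝ → Set _
  Gap θ m x = Σ Interval λ I → Avoids I θ m × x ≈ length I

  Gap-cong : ∀ {t θ m x} → t ≈ θ → Gap θ m x → Gap t m x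
  Gap-cong {t} {θ} t≈θ (I , avoids , x≈) = I ,
    (λ y∈I z k k≤m y+z≈kt → avoids y∈I z k k≤m
      (trans y+z≈kt (trans (·≈* k t) (trans (*-congˡ t≈θ) (sym (·≈* k θ)))))) , x≈

  Gap-neg : ∀ {t θ m x} → t ≈ - θ → Gap θ m x → Gap t m x
  Gap-neg {t} {θ} {m} t≈-θ (I , avoids , x≈) = -I , avoids′ ,
      trans x≈ (solve 2 (λ l r → r :- l := :- l :- :- r) refl _ _)
    where
    open Interval I
    -I : Interval
    -I = record { left = - right ; right = - left ; left≤right = ≤-neg left≤right
                ; leftEnd = rightEnd ; rightEnd = leftEnd }

    flipʳ : ∀ e {x y} → Precedes e (- y) x → Precedes e (- x) y
    flipʳ included {x} {y} p = ≤-respʳ (solve 1 (λ y → :- :- y := y) refl y) (≤-neg p)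
    flipʳ excluded {x} {y} p = <-respʳ-≈ (solve 1 (λ y → :- :- y := y) refl y) (<-neg p)

    flipˡ : ∀ e {x y} → Precedes e x (- y) → Precedes e y (- x)
    flipˡ included {x} {y} p = ≤-respˡ (solve 1 (λ y → :- :- y := y) refl y) (≤-neg p)
    flipˡ excluded {x} {y} p = <-respˡ-≈ (solve 1 (λ y → :- :- y := y) refl y) (<-neg p)

    avoids′ : Avoids -I t m
    avoids′ {y} (l , r) z k k≤m y+z≈kt =
      avoids {(- y)} (flipˡ leftEnd r , flipʳ rightEnd l) (ℤ.- z) k k≤m
        (trans (+-congˡ (fromℤ-neg z))
        (trans (solve 2 (λ y z → :- y :+ :- z := :- (y :+ z)) refl y (fromℤ z))
        (trans (-‿cong (trans y+z≈kt (trans (·≈* k t) (*-congˡ t≈-θ))))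
        (trans (solve 2 (λ k θ → :- (k :* :- θ) := k :* θ) refl ⌜ k ⌝ θ) (sym (·≈* k θ))))))

  -- Two consecutive convergents p′/q′ and p/q of t = ±θ on either side of t,
  -- the sign of t being chosen so that q′t - p′ > 0 > qt - p.  The number x is
  -- the complete quotient, and q is stored as suc r.
  record Basis (θ x : ℝ) : Set (c Level.⊔ ℓ₁ Level.⊔ ℓ₂) where
    field
      t     : ℝ
      t≈±θ  : t ≈ θ ⊎ t ≈ - θ
      r q′  : ℕ
      p p′  : ℤ
      det≡1 : + q′ ℤ.* p ≡ 1ℤ ℤ.+ +[1+ r ] ℤ.* p′

      0<x   : 0# < x
      ratio : ⌜ q′ ⌝ * t - fromℤ p′ ≈ x * (fromℤ p - ⌜ suc r ⌝ * t)

  module BasisProperties {θ x} (basis : Basis θ x) where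

    open Basis basis public

    q Q′ P P′ u v : ℝ
    q = ⌜ suc r ⌝
    Q′ = ⌜ q′ ⌝
    P = fromℤ p
    P′ = fromℤ p′
    u = Q′ * t - P′
    v = P - q * t

    det≈1 : Q′ * P - q * P′ ≈ 1#
    det≈1 = trans (+-congʳ (trans (sym (fromℤ-* (+ q′) p)) (trans (fromℤ-≡ det≡1)
      (trans (fromℤ-+ 1ℤ (+[1+ r ] ℤ.* p′)) (+-cong (+-identityʳ 1#) (fromℤ-* +[1+ r ] p′))))))
      (solve 2 (λ q p → con 1ℤ :+ q :* p :- q :* p := con 1ℤ) refl q P′)

    q*u+Q′*v≈1 : q * u + Q′ * v ≈ 1#
    q*u+Q′*v≈1 = trans
      (solve 5 (λ q Q′ P P′ t → q :* (Q′ :* t :- P′) :+ Q′ :* (P :- q :* t) := Q′ :* P :- q :* P′)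
        refl q Q′ P P′ t) det≈1

    -- Substituting `u = x v` into `q u + q′ v = 1` gives `(q x + q′) v = 1`, where the first factor
    -- is positive.
    0<v : 0# < v
    0<v = *-cancelˡ-pos {q * x + Q′} (<⇒≤ (+-pos-nonneg (*-positive (0<suc r) 0<x) (⌜⌝-nonneg q′)))
      (<-respʳ-≈ (sym (trans (solve 4 (λ q x Q′ v → (q :* x :+ Q′) :* v := q :* (x :* v) :+ Q′ :* v) refl q x Q′ v)
                 (trans (+-congʳ (*-congˡ (sym ratio))) q*u+Q′*v≈1))) 0<1)

    0<u : 0# < u
    0<u = <-respʳ-≈ (sym ratio) (*-positive 0<x 0<v)

    Gap⇒Gap-t : ∀ {m d} → Gap θ m d → Gap t m d
    Gap⇒Gap-t with t≈±θ
    ... | inj₁ t≈θ  = Gap-cong t≈θ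
    ... | inj₂ t≈-θ = Gap-neg t≈-θ

    Gap-t⇒Gap : ∀ {m d} → Gap t m d → Gap θ m d
    Gap-t⇒Gap with t≈±θ
    ... | inj₁ t≈θ  = Gap-cong (sym t≈θ)
    ... | inj₂ t≈-θ = Gap-neg (trans (solve 1 (λ θ → θ := :- :- θ) refl θ) (-‿cong (sym t≈-θ)))

    -- The points of index r and r + q′ are neighbours up to index 2r + q′.
    gap-u : ∀ {m} → m ℕ.≤ r ℕ.+ r ℕ.+ q′ → Gap θ m u
    gap-u {m} m≤ = Gap-t⇒Gap (I , avoids , solve 2 (λ L u → u := L :+ u :- L) refl L u)
      where
      L = ⌜ r ⌝ * t
      I : Interval
      I = record { left = L ; right = L + u ; leftEnd = excluded ; rightEnd = excluded
                 ; left≤right = <⇒≤ (by-pos 0<u (solve 2 (λ L u → L :+ u :- L := u) refl L u)) }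

      avoids : Avoids I t m
      -- Let `A`, `B` be the coordinates of `(k - r, z)`. Then `A u - B v = y - L` lies strictly
      -- between 0 and `u`, and `A q′ + B q = k - r` lies between `-r` and `r + q′`. In the order of
      -- the clauses: `A ≤ 0 ≤ B` gives a displacement at most 0; `A ≥ 1`, `B ≤ 0` one of at least
      -- `u`; `A ≤ 0`, `B ≤ -1` an index difference at most `-q`; `A, B ≥ 1` one of at least
      -- `q + q′`.
      avoids {y} (L<y , y<L+u) z k k≤m y+z≈kt = cases (fromℤ≤0⊎1≤ a) (fromℤ≤0⊎1≤ b) (0≤fromℤ⊎≤-1 b)
        where
        j = + k ℤ.- + r
        a = j ℤ.* p ℤ.- z ℤ.* +[1+ r ]
        b = z ℤ.* + q′ ℤ.- j ℤ.* p′
        J = fromℤ j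
        Z = fromℤ z
        A = fromℤ a
        B = fromℤ b
        K = ⌜ k ⌝

        J≈ : J ≈ K - ⌜ r ⌝
        J≈ = fromℤ-minus (+ k) (+ r)

        k≤ : ⌜ k ⌝ ≤ ⌜ r ⌝ + ⌜ r ⌝ + Q′
        k≤ = ≤-respʳ (trans (⌜⌝-+ (r ℕ.+ r) q′) (+-congʳ (⌜⌝-+ r r))) (⌜⌝-mono-≤ (ℕₚ.≤-trans k≤m m≤))

        value : A * u - B * v ≈ y - L
        value = trans (+-cong (*-congʳ (fromℤ-det j p z +[1+ r ])) (-‿cong (*-congʳ (fromℤ-det z (+ q′) j p′))))
          (trans (coordinates J Z P P′ q Q′ t) (trans (*-congˡ det≈1) (trans (*-identityʳ _)
          (trans (+-congʳ (*-congʳ J≈))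
          (trans (solve 4 (λ K r t Z → (K :- r) :* t :- Z := K :* t :- Z :- r :* t) refl K ⌜ r ⌝ t Z)
          (trans (+-congʳ (+-congʳ (sym (trans y+z≈kt (·≈* k t)))))
            (solve 3 (λ y Z L → y :+ Z :- Z :- L := y :- L) refl y Z L)))))))

        index : A * Q′ + B * q ≈ K - ⌜ r ⌝
        index = trans (+-cong (*-congʳ (fromℤ-det j p z +[1+ r ])) (*-congʳ (fromℤ-det z (+ q′) j p′)))
          (trans (solve 6 (λ J Z P P′ q Q′ → (J :* P :- Z :* q) :* Q′ :+ (Z :* Q′ :- J :* P′) :* q
                    := J :* (Q′ :* P :- q :* P′)) refl J Z P P′ q Q′)
          (trans (*-congˡ det≈1) (trans (*-identityʳ J) J≈)))

        cases : A ≤ 0# ⊎ 1# ≤ A → B ≤ 0# ⊎ 1# ≤ B → 0# ≤ B ⊎ B ≤ - 1# → _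
        cases (inj₁ A≤0) _ (inj₁ 0≤B) = absurd
          (+-pos-nonneg (+-pos-nonneg (pos L<y) (*-nonneg (nonneg A≤0) (<⇒≤ 0<u))) (*-nonneg 0≤B (<⇒≤ 0<v)))
          (trans (solve 6 (λ A B u v y L → y :- L :+ (con 0ℤ :- A) :* u :+ B :* v := y :- L :- (A :* u :- B :* v))
            refl A B u v y L) (diff≈0 (sym value)))
        cases (inj₂ 1≤A) (inj₁ B≤0) _ = absurd
          (+-pos-nonneg (+-pos-nonneg (pos y<L+u) (*-nonneg (nonneg 1≤A) (<⇒≤ 0<u)))
            (*-nonneg (nonneg B≤0) (<⇒≤ 0<v)))
          (trans (solve 6 (λ A B u v y L → L :+ u :- y :+ (A :- con 1ℤ) :* u :+ (con 0ℤ :- B) :* v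
                    := A :* u :- B :* v :- (y :- L)) refl A B u v y L) (diff≈0 value))
        cases (inj₁ A≤0) _ (inj₂ B≤-1) = absurd
          (+-pos-nonneg (+-pos-nonneg (+-pos-nonneg 0<1 (⌜⌝-nonneg k)) (*-nonneg (nonneg A≤0) (⌜⌝-nonneg q′)))
            (*-nonneg (nonneg B≤-1) (<⇒≤ (0<suc r))))
          (trans (solve 5 (λ A B K r Q′ → con 1ℤ :+ K :+ (con 0ℤ :- A) :* Q′ :+ (:- con 1ℤ :- B) :* (con 1ℤ :+ r)
                    := (K :- r) :- (A :* Q′ :+ B :* (con 1ℤ :+ r))) refl A B K ⌜ r ⌝ Q′) (diff≈0 (sym index)))
        cases (inj₂ 1≤A) (inj₂ 1≤B) _ = absurd
          (+-pos-nonneg (+-pos-nonneg (+-pos-nonneg 0<1 (nonneg k≤)) (*-nonneg (nonneg 1≤A) (⌜⌝-nonneg q′)))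
            (*-nonneg (nonneg 1≤B) (<⇒≤ (0<suc r))))
          (trans (solve 5 (λ A B K r Q′ → con 1ℤ :+ (r :+ r :+ Q′ :- K) :+ (A :- con 1ℤ) :* Q′ :+ (B :- con 1ℤ) :* (con 1ℤ :+ r)
                    := (A :* Q′ :+ B :* (con 1ℤ :+ r)) :- (K :- r)) refl A B K ⌜ r ⌝ Q′) (diff≈0 index))

    -- Walking along the circle from 0 by q′t when the index stays below q + q′,
    -- and by -qt otherwise, one moves right by u or v ≤ u, so that no interval
    -- longer than u is jumped over.
    u-bound : ∀ {m} → r ℕ.+ q′ ℕ.≤ m → v ≤ u → IsUpperBound (Gap θ m) u
    u-bound {m} m≥ v≤u d gap u<d with Gap⇒Gap-t gap
    ... | I , avoids , d≈ = overtake
      where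
      open Interval I
      n₀ = proj₁ (archimedean (- left))

      -- The invariant of the walk: after `n` moves the point is still not beyond `left`, yet it has
      -- advanced by at least `n v` from its start `-n₀`. For large `n` this contradicts the
      -- Archimedean property.
      Visited : ℕ → Set _
      Visited n = Σ (ℕ × ℤ) λ (j , z) → j ℕ.≤ r ℕ.+ q′ ×
        let y = ⌜ j ⌝ * t - fromℤ z in y ≤ left × - ⌜ n₀ ⌝ + ⌜ n ⌝ * v ≤ y

      weaken : ∀ e {x y} → x < y → Precedes e x y
      weaken included = <⇒≤
      weaken excluded x<y = x<y

      -- A move of at most `u` from a point not beyond `left` ends before `left + d = right`; if it
      -- passed `left`, it would land inside the interval.
      stay : ∀ j z y → j ℕ.≤ r ℕ.+ q′ → y ≤ left → ⌜ j ⌝ * t - fromℤ z ≤ y + u → ⌜ j ⌝ * t - fromℤ z ≤ left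
      stay j z y j≤ y≤left ≤y+u left<y′ = avoids
        (weaken leftEnd left<y′ , weaken rightEnd (≤-<-trans ≤y+u (by-pos
          (+-pos-nonneg (pos u<d) (nonneg y≤left))
          (trans (solve 4 (λ l r y u → r :- (y :+ u) := r :- l :- u :+ (l :- y)) refl left right y u)
            (+-congʳ (+-congʳ (sym d≈)))))))
        z j (ℕₚ.≤-trans j≤ m≥)
        (trans (solve 2 (λ a z → a :- z :+ z := a) refl (⌜ j ⌝ * t) (fromℤ z)) (sym (·≈* j t)))

      move : ∀ {n} → Visited n → Visited (suc n)
      move {n} ((j , z) , j≤ , y≤left , ≤y) with j ℕₚ.≤? r
      ... | yes j≤r = (j ℕ.+ q′ , z ℤ.+ p′) , j′≤ , stay (j ℕ.+ q′) (z ℤ.+ p′) y j′≤ y≤left (≈⇒≤ y′≈) ,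
            ≤-trans (≤-respˡ (solve 3 (λ v s n → v :+ (s :+ n :* v) := s :+ (con 1ℤ :+ n) :* v) refl v (- ⌜ n₀ ⌝) ⌜ n ⌝)
                      (≤-respʳ (+-comm u y) (+-mono-≤ v≤u ≤y))) (≈⇒≤ (sym y′≈))
        where
        y = ⌜ j ⌝ * t - fromℤ z
        j′≤ = ℕₚ.+-monoˡ-≤ q′ j≤r
        y′≈ : ⌜ j ℕ.+ q′ ⌝ * t - fromℤ (z ℤ.+ p′) ≈ y + u
        y′≈ = trans (+-cong (*-congʳ (⌜⌝-+ j q′)) (-‿cong (fromℤ-+ z p′)))
          (solve 5 (λ j Q′ t z P′ → (j :+ Q′) :* t :- (z :+ P′) := j :* t :- z :+ (Q′ :* t :- P′))
            refl ⌜ j ⌝ Q′ t (fromℤ z) P′)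
      ... | no j≰r = (j ℕ.∸ suc r , z ℤ.- p) , j′≤ ,
            stay (j ℕ.∸ suc r) (z ℤ.- p) y j′≤ y≤left (≤-trans (≈⇒≤ y′≈) (+-mono-≤ {y} <-irrefl v≤u)) ,
            ≤-trans (≤-respˡ (solve 3 (λ v s n → v :+ (s :+ n :* v) := s :+ (con 1ℤ :+ n) :* v) refl v (- ⌜ n₀ ⌝) ⌜ n ⌝)
                      (≤-respʳ (+-comm v y) (+-mono-≤ {v} <-irrefl ≤y))) (≈⇒≤ (sym y′≈))
        where
        y = ⌜ j ⌝ * t - fromℤ z
        j′≤ = ℕₚ.≤-trans (ℕₚ.m∸n≤m j (suc r)) j≤
        j≈ : ⌜ j ⌝ ≈ ⌜ j ℕ.∸ suc r ⌝ + q
        j≈ = trans (fromℤ-≡ (≡.cong +_ (≡.sym (ℕₚ.m∸n+n≡m (ℕₚ.≰⇒> j≰r))))) (⌜⌝-+ (j ℕ.∸ suc r) (suc r))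
        y′≈ : ⌜ j ℕ.∸ suc r ⌝ * t - fromℤ (z ℤ.- p) ≈ y + v
        y′≈ = trans (+-congˡ (-‿cong (fromℤ-minus z p)))
          (trans (solve 5 (λ j q t z P → j :* t :- (z :- P) := (j :+ q) :* t :- z :+ (P :- q :* t))
            refl ⌜ j ℕ.∸ suc r ⌝ q t (fromℤ z) P)
          (+-congʳ (+-congʳ (*-congʳ (sym j≈)))))

      walk : ∀ n → Visited n
      walk zero = (0 , + n₀) , z≤n ,
        <⇒≤ (by-pos (pos (proj₂ (archimedean (- left))))
          (solve 3 (λ l n t → l :- (con 0ℤ :* t :- n) := n :- :- l) refl left ⌜ n₀ ⌝ t)) ,
        ≈⇒≤ (solve 3 (λ n v t → :- n :+ con 0ℤ :* v := con 0ℤ :* t :- n) refl ⌜ n₀ ⌝ v t)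
      walk (suc n) = move {n} (walk n)

      overtake : ⊥
      overtake = beyond (exceed (left + ⌜ n₀ ⌝) 0<v)
        where
        beyond : ∃[ n ] left + ⌜ n₀ ⌝ < ⌜ n ⌝ * v → ⊥
        beyond (n , left+n₀<nv) = arrive (walk n)
          where
          arrive : Visited n → ⊥
          arrive (_ , _ , y≤left , ≤y) = ≤-trans ≤y y≤left
            (by-pos (pos left+n₀<nv) (solve 3 (λ l s n → :- s :+ n :- l := n :- (l :+ s)) refl left ⌜ n₀ ⌝ (⌜ n ⌝ * v)))

    largest-gap : ∀ {m} → r ℕ.+ q′ ℕ.≤ m → m ℕ.≤ r ℕ.+ r ℕ.+ q′ → v ≤ u → IsLargestGap θ m u
    largest-gap ≤m m≤ v≤u = u-bound ≤m v≤u , λ d bound → bound u (gap-u m≤)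

-- Exchanging the older convergent for the next one flips the sign of the determinant; negating both
-- numerators, as required by the passage from `t` to `- t`, flips it back.
det-step : ∀ Q A q p p′ → q ℤ.* p ≡ 1ℤ ℤ.+ Q ℤ.* p′ →
           Q ℤ.* (ℤ.- (A ℤ.* p ℤ.+ p′)) ≡ 1ℤ ℤ.+ (A ℤ.* Q ℤ.+ q) ℤ.* (ℤ.- p)
det-step Q A q p p′ det≡1 = begin
  Q ℤ.* (ℤ.- (A ℤ.* p ℤ.+ p′))
    ≡⟨ solve 4 (λ Q A p p′ → Q :* (:- (A :* p :+ p′)) :=
         con 1ℤ :+ (:- (A :* Q :* p) :- (con 1ℤ :+ Q :* p′))) ≡.refl Q A p p′ ⟩
  1ℤ ℤ.+ (ℤ.- (A ℤ.* Q ℤ.* p) ℤ.- (1ℤ ℤ.+ Q ℤ.* p′))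
    ≡⟨ ≡.cong (λ d → 1ℤ ℤ.+ (ℤ.- (A ℤ.* Q ℤ.* p) ℤ.- d)) (≡.sym det≡1) ⟩
  1ℤ ℤ.+ (ℤ.- (A ℤ.* Q ℤ.* p) ℤ.- q ℤ.* p)
    ≡⟨ solve 4 (λ Q A p q → con 1ℤ :+ (:- (A :* Q :* p) :- q :* p) :=
         con 1ℤ :+ (A :* Q :+ q) :* (:- p)) ≡.refl Q A p q ⟩
  1ℤ ℤ.+ (A ℤ.* Q ℤ.+ q) ℤ.* (ℤ.- p) ∎
  where
  open ≡.≡-Reasoning
  open +-*-Solver

-- The Euclidean algorithm and complete quotients

module Steps {c ℓ₁ ℓ₂} (R : Reals c ℓ₁ ℓ₂) where

  open RealTheory R
  open OrderedField R
  open Gaps R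

  -- The pair consists of the formal convergent 1/0 and of `a`/1. With `t = - θ` it has `u = 1` and
  -- `v = θ - a`.
  first-basis : ∀ {θ x a} → 0# < x → (θ - fromℤ a) * x ≈ 1# → Basis θ x
  first-basis {θ} {x} {a} 0<x eq = record
    { t = - θ ; t≈±θ = inj₂ refl ; r = 0 ; q′ = 0 ; p = ℤ.- a ; p′ = ℤ.- 1ℤ
    ; det≡1 = ℤₚ.*-zeroˡ (ℤ.- a)
    ; 0<x = 0<x
    ; ratio = trans (solve 1 (λ θ → con 0ℤ :* (:- θ) :- (:- (con 1ℤ :+ con 0ℤ)) := con 1ℤ) refl θ)
        (trans (sym eq) (trans (solve 3 (λ θ a x → (θ :- a) :* x := x :* (:- a :- (con 1ℤ :+ con 0ℤ) :* (:- θ))) refl θ (fromℤ a) x)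
          (*-congˡ (+-congʳ (sym (fromℤ-neg a))))))
    }

  -- One division in the Euclidean algorithm: `(u, v)` becomes `(v, u - A v)`, and
  -- `u - A v = (x - A) v`, so the new ratio is `x′ = 1 / (x - A)`. The quotient `A` is given as
  -- `suc a`, and the new denominator `A q + q′` is again stored as its predecessor.
  step : ∀ {θ x x′} → Basis θ x → ∀ a → 0# < x′ → (x - ⌜ suc a ⌝) * x′ ≈ 1# → Basis θ x′
  step {θ} {x} {x′} basis a 0<x′ eq = record
    { t = - t
    ; t≈±θ = Sum.[ (λ t≈θ → inj₂ (-‿cong t≈θ))
                 , (λ t≈-θ → inj₁ (trans (-‿cong t≈-θ) (solve 1 (λ θ → :- :- θ := θ) refl θ))) ] t≈±θ
    ; r = r ℕ.+ (a ℕ.* suc r ℕ.+ q′)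
    ; q′ = suc r
    ; p = ℤ.- (+[1+ a ] ℤ.* p ℤ.+ p′)
    ; p′ = ℤ.- p
    ; det≡1 = det′
    ; 0<x = 0<x′
    ; ratio = trans (+-congˡ (-‿cong (fromℤ-neg p)))
        (trans (solve 3 (λ q t P → q :* (:- t) :- (:- P) := P :- q :* t) refl q t P)
        (trans (sym (trans (*-congʳ eq) (*-identityˡ v)))
        (trans (solve 4 (λ x x′ A v → (x :- A) :* x′ :* v := x′ :* (x :* v :- A :* v)) refl x x′ A v)
          (*-congˡ (trans (+-congʳ (sym ratio)) new-v)))))
    }
    where
    open BasisProperties basis
    A = ⌜ suc a ⌝
    q-new : suc (r ℕ.+ (a ℕ.* suc r ℕ.+ q′)) ≡ suc a ℕ.* suc r ℕ.+ q′
    q-new = ≡.cong suc (≡.sym (ℕₚ.+-assoc r _ q′))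
    det′ : +[1+ r ] ℤ.* (ℤ.- (+[1+ a ] ℤ.* p ℤ.+ p′)) ≡ 1ℤ ℤ.+ +[1+ r ℕ.+ (a ℕ.* suc r ℕ.+ q′) ] ℤ.* (ℤ.- p)
    det′ = ≡.trans (det-step +[1+ r ] +[1+ a ] (+ q′) p p′ det≡1)
      (≡.cong (λ n → 1ℤ ℤ.+ n ℤ.* (ℤ.- p))
        (≡.trans (≡.cong (ℤ._+ + q′) (≡.sym (ℤₚ.pos-* (suc a) (suc r)))) (≡.cong +_ (≡.sym q-new))))
    new-v : u - A * v ≈ fromℤ (ℤ.- (+[1+ a ] ℤ.* p ℤ.+ p′)) - ⌜ suc (r ℕ.+ (a ℕ.* suc r ℕ.+ q′)) ⌝ * (- t)
    new-v = sym (trans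
      (+-cong (trans (fromℤ-neg (+[1+ a ] ℤ.* p ℤ.+ p′)) (-‿cong (trans (fromℤ-+ (+[1+ a ] ℤ.* p) p′) (+-congʳ (fromℤ-* +[1+ a ] p)))))
        (-‿cong (*-congʳ (trans (fromℤ-≡ (≡.cong +_ q-new)) (trans (⌜⌝-+ (suc a ℕ.* suc r) q′) (+-congʳ (⌜⌝-* (suc a) (suc r))))))))
      (solve 6 (λ A P P′ q Q′ t → :- (A :* P :+ P′) :- (A :* q :+ Q′) :* (:- t) := Q′ :* t :- P′ :- A :* (P :- q :* t))
        refl A P P′ q Q′ t))

  Basis-resp-≈ : ∀ {θ x y} → x ≈ y → Basis θ x → Basis θ y
  Basis-resp-≈ x≈y basis = record
    { t = t ; t≈±θ = t≈±θ ; r = r ; q′ = q′ ; p = p ; p′ = p′ ; det≡1 = det≡1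
    ; 0<x = <-respʳ-≈ x≈y 0<x ; ratio = trans ratio (*-congʳ x≈y) }
    where open Basis basis

  -- Limits

  limit-≥ : ∀ {s x b} → ConvergesTo s x → (∀ n → b ≤ s (suc n)) → b ≤ x
  limit-≥ {s} {x} {b} s→x b≤s x<b with s→x (b - x) (pos x<b)
  ... | N , close = b≤s N (<-respʳ-≈ (solve 2 (λ x b → x :+ (b :- x) := b) refl x b)
                      (proj₁ (close (suc N) (ℕₚ.n≤1+n N))))

  limit-≤ : ∀ {s x b} → ConvergesTo s x → (∀ n → s (suc n) ≤ b) → x ≤ b
  limit-≤ {s} {x} {b} s→x s≤b b<x with s→x (x - b) (pos b<x)
  ... | N , close = s≤b N (by-pos (pos (proj₂ (close (suc N) (ℕₚ.n≤1+n N))))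
                      (solve 3 (λ s x b → s :- b := s :+ (x :- b) :- x) refl _ x b))

  limit-mono : ∀ {s s′ x y} → ConvergesTo s x → ConvergesTo s′ y → (∀ n → s n ≈ s′ n) → x ≤ y
  limit-mono {s} {s′} {x} {y} s→x s′→y s≈s′ y<x = <-irrefl (<-respʳ-≈ eq (<-trans x<s+ε s+ε<))
    where
    ½ = inv (2 · 1#) (0<suc 1)
    ε = (x - y) * ½
    0<ε = *-positive (pos y<x) (inv-positive _ (0<suc 1))
    N = proj₁ (s→x ε 0<ε)
    N′ = proj₁ (s′→y ε 0<ε)
    n = N ℕ.+ N′
    x<s+ε : x < s n + ε
    x<s+ε = proj₂ (proj₂ (s→x ε 0<ε) n (ℕₚ.m≤m+n N N′))
    s+ε< : s n + ε < y + ε + ε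
    s+ε< = +-mono-<-≤ (<-respˡ-≈ (sym (s≈s′ n)) (proj₁ (proj₂ (s′→y ε 0<ε) n (ℕₚ.m≤n+m N′ N)))) <-irrefl
    eq : y + ε + ε ≈ x
    eq = trans (solve 3 (λ x y h → y :+ (x :- y) :* h :+ (x :- y) :* h := y :+ (x :- y) :* (con (+ 2) :* h)) refl x y ½)
      (trans (+-congˡ (*-congˡ (x*inv≈1 _ (0<suc 1)))) (solve 2 (λ x y → y :+ (x :- y) :* con 1ℤ := x) refl x y))

  -- Continued fractions

  open ContinuedFraction

  tail : ContinuedFraction → ContinuedFraction
  tail a = record { quotient = λ i → quotient a (suc i) ; positive = λ i → positive a (suc i) }

  segment-tail : ∀ a i n → segment (tail a) i n ≡ segment a (suc i) n
  segment-tail a i zero    = ≡.refl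
  segment-tail a i (suc n) = ≡.cong (λ (s , 0<s) → fromℤ (quotient a (suc (suc i))) + inv s 0<s ,
    +-positive (0<fromℤ (positive a (suc i))) (inv-positive s 0<s)) (segment-tail a (suc i) n)

  convergent-tail : ∀ a n → convergent (tail a) n ≡ proj₁ (segment a 0 n)
  convergent-tail a zero    = ≡.refl
  convergent-tail a (suc n) = ≡.cong (λ (s , 0<s) → fromℤ (quotient a 1) + inv s 0<s) (segment-tail a 0 n)

  segment-cong : ∀ a b → (∀ i → quotient a i ≡ quotient b i) →
                 ∀ i n → proj₁ (segment a i n) ≈ proj₁ (segment b i n)
  segment-cong a b a≗b i zero    = fromℤ-≡ (a≗b (suc i))
  segment-cong a b a≗b i (suc n) = +-cong (fromℤ-≡ (a≗b (suc i))) (inv-cong _ _ (segment-cong a b a≗b (suc i) n))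

  convergent-cong : ∀ a b → (∀ i → quotient a i ≡ quotient b i) → ∀ n → convergent a n ≈ convergent b n
  convergent-cong a b a≗b zero    = fromℤ-≡ (a≗b 0)
  convergent-cong a b a≗b (suc n) = +-cong (fromℤ-≡ (a≗b 0)) (inv-cong _ _ (segment-cong a b a≗b 0 n))

  expansion-injective : ∀ {x y a b} → x HasExpansion a → y HasExpansion b →
                        (∀ i → quotient a i ≡ quotient b i) → x ≈ y
  expansion-injective {a = a} {b} x-a y-b a≗b = ≤-antisym
    (limit-mono x-a y-b (convergent-cong a b a≗b)) (limit-mono y-b x-a λ n → sym (convergent-cong a b a≗b n))

  HasExpansion-resp-≈ : ∀ {x y a} → x ≈ y → x HasExpansion a → y HasExpansion a
  HasExpansion-resp-≈ x≈y x-a ε 0<ε with x-a ε 0<ε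
  ... | N , close = N , λ n N≤n → <-respʳ-≈ (+-congʳ x≈y) (proj₁ (close n N≤n)) ,
                                  <-respˡ-≈ x≈y (proj₂ (close n N≤n))

  1≤fromℤ : ∀ {z} → 0ℤ ℤ.< z → 1# ≤ fromℤ z
  1≤fromℤ 0<z = ≤-respˡ (+-identityʳ 1#) (fromℤ-mono-≤ (ℤₚ.i<j⇒suc[i]≤j 0<z))

  inv-antitone : ∀ {x y} (0<x : 0# < x) (0<y : 0# < y) → x ≤ y → inv y 0<y ≤ inv x 0<x
  inv-antitone {x} {y} 0<x 0<y x≤y = by-nonneg
    (*-nonneg (nonneg x≤y) (<⇒≤ (*-positive (inv-positive x 0<x) (inv-positive y 0<y))))
    (sym (trans (solve 4 (λ x y i j → (y :- x) :* (i :* j) := i :* (y :* j) :- j :* (x :* i)) refl x y _ _)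
      (+-cong (trans (*-congˡ (x*inv≈1 y 0<y)) (*-identityʳ _))
              (-‿cong (trans (*-congˡ (x*inv≈1 x 0<x)) (*-identityʳ _))))))

  inv≤1 : ∀ {x} (0<x : 0# < x) → 1# ≤ x → inv x 0<x ≤ 1#
  inv≤1 {x} 0<x 1≤x = by-nonneg (*-nonneg (nonneg 1≤x) (<⇒≤ (inv-positive x 0<x)))
    (trans (+-congʳ (sym (x*inv≈1 x 0<x))) (solve 2 (λ x i → x :* i :- i := (x :- con 1ℤ) :* i) refl x _))

  segment-≥ : ∀ a i n → fromℤ (quotient a (suc i)) ≤ proj₁ (segment a i n)
  segment-≥ a i zero    = <-irrefl
  segment-≥ a i (suc n) = by-nonneg (<⇒≤ (inv-positive _ (proj₂ (segment a (suc i) n))))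
    (solve 2 (λ a i → a :+ i :- a := i) refl _ _)

  1≤segment : ∀ a i n → 1# ≤ proj₁ (segment a i n)
  1≤segment a i n = ≤-trans (1≤fromℤ (positive a i)) (segment-≥ a i n)

  segment-≤ : ∀ a i n → proj₁ (segment a i n) ≤ fromℤ (quotient a (suc i)) + 1#
  segment-≤ a i zero    = <⇒≤ (by-pos 0<1 (solve 1 (λ a → a :+ con 1ℤ :- a := con 1ℤ) refl _))
  segment-≤ a i (suc n) = +-mono-≤ <-irrefl (inv≤1 _ (1≤segment a (suc i) n))

  expansion-≤ : ∀ {x a} → x HasExpansion a → x ≤ fromℤ (quotient a 0) + 1#
  expansion-≤ {x} {a} x-a = limit-≤ x-a λ n → +-mono-≤ <-irrefl (inv≤1 (proj₂ (segment a 0 n)) (1≤segment a 0 n))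

  -- The convergents of the tail are the segments `s n`, and `s n - x′ = s n x′ (x - c)` with `c`
  -- the convergent of index `n + 1`. Since `s n ≤ T`, convergence to `x` carries over to the tail.
  complete-quotient : ∀ {x a} → x HasExpansion a →
    ∃[ x′ ] 0# < x′ × (x - fromℤ (quotient a 0)) * x′ ≈ 1# × x′ HasExpansion tail a
  complete-quotient {x} {a} x-a = x′ , 0<x′ , x*inv≈1 _ 0<x-a₀ , converges
    where
    a₀ = fromℤ (quotient a 0)
    T = fromℤ (quotient a 1) + 1#
    s : ℕ → ℝ
    s n = proj₁ (segment a 0 n)
    0<T = +-positive (0<fromℤ (positive a 0)) 0<1
    -- Positive terms alone would only give a nonnegative limit. The uniform lower bound `a₀ + 1/T`
    -- on the convergents keeps the inequality strict.
    0<x-a₀ : 0# < x - a₀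
    0<x-a₀ = by-pos (+-pos-nonneg (inv-positive T 0<T) (nonneg (limit-≥ x-a λ n →
        +-mono-≤ {a₀} <-irrefl (inv-antitone (proj₂ (segment a 0 n)) 0<T (segment-≤ a 0 n)))))
      (solve 3 (λ x a i → x :- a :- con 0ℤ := i :+ (x :- (a :+ i))) refl x a₀ _)
    x′ = inv _ 0<x-a₀
    0<x′ = inv-positive _ 0<x-a₀

    error : ∀ n → s n - x′ ≈ s n * x′ * (x - convergent a (suc n))
    error n = sym (trans (solve 5 (λ s x′ x a i → s :* x′ :* (x :- (a :+ i)) := s :* ((x :- a) :* x′) :- x′ :* (s :* i)) refl (s n) x′ x a₀ _)
      (+-cong (trans (*-congˡ (x*inv≈1 _ 0<x-a₀)) (*-identityʳ _))
              (-‿cong (trans (*-congˡ (x*inv≈1 _ (proj₂ (segment a 0 n)))) (*-identityʳ _)))))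

    0<Tx′ = *-positive 0<T 0<x′

    -- |s n - x′| ≤ T x′ |x - cₙ₊₁|
    scaled : ∀ n {d ε} → d < ε * inv _ 0<Tx′ → 0# < ε → s n * x′ * d < ε
    scaled n {d} {ε} d<δ 0<ε = by-pos
      (+-pos-nonneg (*-positive 0<sx′ (pos d<δ)) (*-nonneg (*-nonneg (nonneg (segment-≤ a 0 n)) (<⇒≤ 0<x′)) (<⇒≤ 0<δ)))
      (sym (trans (solve 6 (λ s T x′ d e i → s :* x′ :* (e :* i :- d) :+ (T :- s) :* x′ :* (e :* i) := e :* (T :* x′ :* i) :- s :* x′ :* d) refl (s n) T x′ d ε _)
        (+-congʳ (trans (*-congˡ (x*inv≈1 _ 0<Tx′)) (*-identityʳ ε)))))
      where
      0<δ = *-positive 0<ε (inv-positive _ 0<Tx′)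
      0<sx′ = *-positive (proj₂ (segment a 0 n)) 0<x′

    within : ∀ {ε} n → 0# < ε → Within (ε * inv _ 0<Tx′) (convergent a (suc n)) x → Within ε (s n) x′
    within {ε} n 0<ε (c<x+δ , x<c+δ) =
      by-pos (pos (scaled n (by-pos (pos x<c+δ) (solve 3 (λ x c δ → δ :- (x :- c) := c :+ δ :- x) refl x γ _)) 0<ε))
        (trans (solve 3 (λ s x e → x :+ e :- s := e :- (s :- x)) refl (s n) x′ ε) (+-congˡ (-‿cong (error n)))) ,
      by-pos (pos (scaled n (by-pos (pos c<x+δ) (solve 3 (λ x c δ → δ :- (c :- x) := x :+ δ :- c) refl x γ _)) 0<ε))
        (trans (solve 3 (λ s x e → s :+ e :- x := e :+ (s :- x)) refl (s n) x′ ε)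
        (trans (+-congˡ (error n)) (solve 5 (λ s x′ x c e → e :+ s :* x′ :* (x :- c) := e :- s :* x′ :* (c :- x)) refl (s n) x′ x γ ε)))
      where γ = convergent a (suc n)

    converges : x′ HasExpansion tail a
    converges ε 0<ε =
      let N , close = x-a (ε * inv _ 0<Tx′) (*-positive 0<ε (inv-positive _ 0<Tx′)) in
      N , λ n N≤n → ≡.subst (λ c → Within ε c x′) (≡.sym (convergent-tail a n))
        (within n 0<ε (close (suc n) (ℕₚ.m≤n⇒m≤1+n N≤n)))

  drop : ℕ → ContinuedFraction → ContinuedFraction
  drop zero    a = a
  drop (suc m) a = drop m (tail a)

  quotient-drop : ∀ m a i → quotient (drop m a) i ≡ quotient a (m ℕ.+ i)
  quotient-drop zero    a i = ≡.refl
  quotient-drop (suc m) a i = quotient-drop m (tail a) i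

  positive-step : ∀ {θ x x′ z} → 0ℤ ℤ.< z → Basis θ x → 0# < x′ → (x - fromℤ z) * x′ ≈ 1# → Basis θ x′
  positive-step {z = +[1+ n ]} _ basis = step basis n
  positive-step {z = + zero}   (ℤ.+<+ ())

  basis-drop : ∀ {θ x} m a → Basis θ x → x HasExpansion a → 0ℤ ℤ.< quotient a 0 →
               ∃[ y ] Basis θ y × y HasExpansion drop m a
  basis-drop zero    a basis x-a _ = _ , basis , x-a
  basis-drop {θ} {x} (suc m) a basis x-a 0<a₀ = next (complete-quotient x-a)
    where
    next : ∃[ x′ ] 0# < x′ × (x - fromℤ (quotient a 0)) * x′ ≈ 1# × x′ HasExpansion tail a →
           ∃[ y ] Basis θ y × y HasExpansion drop (suc m) a
    next (x′ , 0<x′ , eq , x′-a) =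
      basis-drop m (tail a) (positive-step {z = quotient a 0} 0<a₀ basis 0<x′ eq) x′-a (positive a 0)

  -- The leading quotient can be any integer and is absorbed by `first-basis`, so at least one term
  -- is dropped. This fits the positive prefix lengths in `≍`.
  basis-of-expansion : ∀ {θ} m a → θ HasExpansion a → ∃[ x ] Basis θ x × x HasExpansion drop (suc m) a
  basis-of-expansion {θ} m a θ-a = next (complete-quotient θ-a)
    where
    next : ∃[ x ] 0# < x × (θ - fromℤ (quotient a 0)) * x ≈ 1# × x HasExpansion tail a →
           ∃[ y ] Basis θ y × y HasExpansion drop (suc m) a
    next (x , 0<x , eq , x-a) =
      basis-drop m (tail a) (first-basis {a = quotient a 0} 0<x eq) x-a (positive a 0)

-- Golden tails have small gaps

module Golden {c ℓ₁ ℓ₂} (R : Reals c ℓ₁ ℓ₂)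
  (√5 : Reals.ℝ R) (0<√5 : Reals._<_ R (Reals.0# R) √5)
  (√5²≈5 : Reals._≈_ R (Reals._*_ R √5 √5) (Reals._·_ R 5 (Reals.1# R))) where

  open RealTheory R
  open OrderedField R
  open Gaps R
  open Steps R
  open ContinuedFraction

  φ : ℝ
  φ = goldenRatio √5

  bound : ℝ
  bound = 1# + (2 · 1#) * inv √5 0<√5

  2φ≈1+√5 : (2 · 1#) * φ ≈ 1# + √5
  2φ≈1+√5 = trans (solve 3 (λ t s i → t :* (s :* i) := s :* (t :* i)) refl (2 · 1#) (1# + √5) _)
    (trans (*-congˡ (x*inv≈1 _ (0<suc 1))) (*-identityʳ _))

  √5≈2φ-1 : √5 ≈ (2 · 1#) * φ - 1#
  √5≈2φ-1 = sym (trans (+-congʳ 2φ≈1+√5) (solve 1 (λ s → con 1ℤ :+ s :- con 1ℤ := s) refl √5))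

  φ²≈φ+1 : φ * φ ≈ φ + 1#
  φ²≈φ+1 = *-cancelˡ-≈ (0<suc 3)
    (trans (solve 1 (λ φ → con (+ 4) :* (φ :* φ) := con (+ 2) :* φ :* (con (+ 2) :* φ)) refl φ)
    (trans (*-cong 2φ≈1+√5 2φ≈1+√5)
    (trans (solve 1 (λ s → (con 1ℤ :+ s) :* (con 1ℤ :+ s) := con 1ℤ :+ con (+ 2) :* s :+ s :* s) refl √5)
    (trans (+-congˡ √5²≈5)
    (trans (solve 1 (λ s → con 1ℤ :+ con (+ 2) :* s :+ con (+ 5) := con (+ 2) :* (con 1ℤ :+ s) :+ con (+ 4)) refl √5)
    (trans (+-congʳ (*-congˡ (sym 2φ≈1+√5)))
      (solve 1 (λ φ → con (+ 2) :* (con (+ 2) :* φ) :+ con (+ 4) := con (+ 4) :* (φ :+ con 1ℤ)) refl φ)))))))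

  0<φ : 0# < φ
  0<φ = *-positive (+-positive 0<1 0<√5) (inv-positive _ (0<suc 1))

  [φ-1]*φ≈1 : (φ - 1#) * φ ≈ 1#
  [φ-1]*φ≈1 = trans (solve 1 (λ φ → (φ :- con 1ℤ) :* φ := φ :* φ :- φ) refl φ)
    (trans (+-congʳ φ²≈φ+1) (solve 1 (λ φ → φ :+ con 1ℤ :- φ := con 1ℤ) refl φ))

  0<φ-1 : 0# < φ - 1#
  0<φ-1 = *-cancelˡ-pos (<⇒≤ 0<φ) (<-respʳ-≈ (sym (trans (*-comm _ _) [φ-1]*φ≈1)) 0<1)

  1<φ : 1# < φ
  1<φ = by-pos 0<φ-1 refl

  0<2-φ : 0# < 2 · 1# - φ
  0<2-φ = *-cancelˡ-pos (<⇒≤ 0<φ) (<-respʳ-≈ (sym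
    (trans (solve 1 (λ φ → φ :* (con (+ 2) :- φ) := con (+ 2) :* φ :- φ :* φ) refl φ)
    (trans (+-congˡ (-‿cong φ²≈φ+1)) (solve 1 (λ φ → con (+ 2) :* φ :- (φ :+ con 1ℤ) := φ :- con 1ℤ) refl φ)))) 0<φ-1)

  -- Expansion of φ

  ≡1 : ∀ {z} → 0ℤ ℤ.< z → z ℤ.< + 2 → z ≡ 1ℤ
  ≡1 {+ 1} _ _ = ≡.refl
  ≡1 { -[1+ n ] } ()
  ≡1 {+ 0} (ℤ.+<+ ())
  ≡1 {+ suc (suc n)} _ (ℤ.+<+ (s≤s (s≤s ())))

  -- The expansion of `φ` that comes with `θ ≍ φ` is arbitrary, so its terms have to be determined.
  -- Here `b₀ < φ < 2` and `1 < φ ≤ b₀ + 1` leave only 1.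
  first-quotient : ∀ {b} → φ HasExpansion b → quotient b 0 ≡ 1ℤ
  first-quotient {b} φ-b = ≡1
    (fromℤ-cancel-< (<-≤-trans 0<φ-1 (≤-respʳ (solve 1 (λ z → z :+ con 1ℤ :- con 1ℤ := z) refl _)
      (+-mono-≤ (expansion-≤ {a = b} φ-b) <-irrefl))))
    (fromℤ-cancel-< (below (complete-quotient φ-b)))
    where
    z = fromℤ (quotient b 0)
    below : ∃[ x ] 0# < x × (φ - z) * x ≈ 1# × x HasExpansion tail b → z < fromℤ (+ 2)
    below (x , 0<x , eq , _) = by-pos
      (+-positive 0<2-φ (*-cancelˡ-pos (<⇒≤ 0<x) (<-respʳ-≈ (sym (trans (*-comm _ _) eq)) 0<1)))
      (solve 2 (λ z φ → con (+ 2) :- z := con (+ 2) :- φ :+ (φ :- z)) refl z φ)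

  golden-tail : ∀ {b} → φ HasExpansion b → φ HasExpansion tail b
  golden-tail {b} φ-b = next (complete-quotient φ-b)
    where
    next : ∃[ x ] 0# < x × (φ - fromℤ (quotient b 0)) * x ≈ 1# × x HasExpansion tail b → φ HasExpansion tail b
    next (x , 0<x , eq , x-b) = HasExpansion-resp-≈ {a = tail b} (*-cancelˡ-≈ 0<φ-1
      (trans (*-congʳ (+-congˡ (-‿cong (sym (trans (fromℤ-≡ (first-quotient φ-b)) (+-identityʳ 1#))))))
        (trans eq (sym [φ-1]*φ≈1)))) x-b

  golden-drop : ∀ n {b} → φ HasExpansion b → φ HasExpansion drop n b
  golden-drop zero        φ-b = φ-b
  golden-drop (suc n) {b} φ-b = golden-drop n {tail b} (golden-tail {b} φ-b)

  -- Every tail of an expansion of `φ` converges to `φ`, and equal tails have equal limits. Hence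
  -- the complete quotient of θ at the matching place is exactly `φ`, and from there on every step
  -- can use quotient 1.
  golden-basis : ∀ {θ} → θ ≍ φ → Basis θ φ
  golden-basis {θ} (a , b , θ-a , φ-b , suc m , n , _ , _ , agree) = finish (basis-of-expansion m a θ-a)
    where
    finish : ∃[ x ] Basis θ x × x HasExpansion drop (suc m) a → Basis θ φ
    finish (x , basis , x-a) = Basis-resp-≈
      (expansion-injective {a = drop (suc m) a} {b = drop n b} x-a (golden-drop n {b} φ-b) λ i →
        ≡.trans (quotient-drop (suc m) a i) (≡.trans (agree i) (≡.sym (quotient-drop n b i))))
      basis

  -- Upper bound

  [φ-1]x≈1 : (φ - ⌜ 1 ⌝) * φ ≈ 1#
  [φ-1]x≈1 = trans (*-congʳ (+-congˡ (-‿cong (+-identityʳ 1#)))) [φ-1]*φ≈1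

  golden-step : ∀ {θ} → Basis θ φ → Basis θ φ
  golden-step basis = step basis 0 0<φ [φ-1]x≈1

  module _ {θ : ℝ} where

    -- The conjugate product (q - φ q′) (q + q′ / φ).
    norm : Basis θ φ → ℝ
    norm basis = q * q - q * Q′ - Q′ * Q′
      where open BasisProperties basis

    -- Two-sided because every golden step negates the norm and so swaps the two inequalities. The
    -- bound is a natural number so that it can be compared with the denominators.
    NormBounded : ℕ → Basis θ φ → Set _
    NormBounded k basis = norm basis ≤ ⌜ k ⌝ × - norm basis ≤ ⌜ k ⌝

    norm-bounded : (basis : Basis θ φ) → ∃[ k ] NormBounded k basis
    norm-bounded basis = suc r ℕ.* suc r ℕ.+ (suc r ℕ.* q′ ℕ.+ q′ ℕ.* q′) ,
      by-nonneg (+-nonneg (+-nonneg qQ QQ) (+-nonneg qQ QQ)) (trans (+-congʳ k≈)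
        (solve 2 (λ q Q → q :* q :+ (q :* Q :+ Q :* Q) :- (q :* q :- q :* Q :- Q :* Q)
           := q :* Q :+ Q :* Q :+ (q :* Q :+ Q :* Q)) refl q Q′)) ,
      by-nonneg (+-nonneg qq qq) (trans (+-congʳ k≈)
        (solve 2 (λ q Q → q :* q :+ (q :* Q :+ Q :* Q) :- (:- (q :* q :- q :* Q :- Q :* Q))
           := q :* q :+ q :* q) refl q Q′))
      where
      open BasisProperties basis
      qq = *-nonneg (⌜⌝-nonneg (suc r)) (⌜⌝-nonneg (suc r))
      qQ = *-nonneg (⌜⌝-nonneg (suc r)) (⌜⌝-nonneg q′)
      QQ = *-nonneg (⌜⌝-nonneg q′) (⌜⌝-nonneg q′)
      k≈ : ⌜ suc r ℕ.* suc r ℕ.+ (suc r ℕ.* q′ ℕ.+ q′ ℕ.* q′) ⌝ ≈ q * q + (q * Q′ + Q′ * Q′)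
      k≈ = trans (⌜⌝-+ (suc r ℕ.* suc r) _) (+-cong (⌜⌝-* (suc r) (suc r))
             (trans (⌜⌝-+ (suc r ℕ.* q′) _) (+-cong (⌜⌝-* (suc r) q′) (⌜⌝-* q′ q′))))

    norm-step : (basis : Basis θ φ) → norm (golden-step basis) ≈ - norm basis
    norm-step basis = trans
      (+-congʳ (+-cong (*-cong q≈ q≈) (-‿cong (*-congʳ q≈))))
      (solve 2 (λ q Q → (q :+ Q) :* (q :+ Q) :- (q :+ Q) :* q :- q :* q := :- (q :* q :- q :* Q :- Q :* Q)) refl q Q′)
      where
      open BasisProperties basis
      q≈ : ⌜ suc (r ℕ.+ q′) ⌝ ≈ q + Q′
      q≈ = ⌜⌝-+ (suc r) q′

    NormBounded-step : ∀ {k} (basis : Basis θ φ) → NormBounded k basis → NormBounded k (golden-step basis)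
    NormBounded-step basis (n≤k , -n≤k) = ≤-respˡ (sym (norm-step basis)) -n≤k ,
      ≤-respˡ (trans (solve 1 (λ n → n := :- :- n) refl (norm basis)) (-‿cong (sym (norm-step basis)))) n≤k

    -- As σ = 2φ - 1, bound·σ = 2φ + 1.  With 1 = qu + q′v, u = φv and E = q - φq′ ≤ 1,
    -- 2φ + 1 - σ (2q + q′ - 1) u = v (2φ + (2 - φ) (1 - E)).
    below-bound : ∀ {k m} (basis : Basis θ φ) → NormBounded k basis → k ℕ.≤ suc (Basis.r basis) →
                  m ℕ.≤ Basis.r basis ℕ.+ Basis.r basis ℕ.+ Basis.q′ basis →
                  suc m · BasisProperties.u basis < bound
    below-bound {k} {m} basis (n≤k , _) k≤q m≤ = ≤-<-trans m+1≤ (*-cancelˡ-< (<⇒≤ 0<√5) main)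
      where
      open BasisProperties basis
      E = q - φ * Q′
      G = φ * φ - (φ + 1#)
      W = (2 · 1#) * φ + (2 · 1# - φ) * (1# - E)

      G≈0 : G ≈ 0#
      G≈0 = diff≈0 φ²≈φ+1

      -- `φ` times the norm is `E (φ q + q′)`. If `E > 1`, this exceeds `φ q ≥ φ k`, against the
      -- bound `k` on the norm.
      E≤1 : E ≤ 1#
      E≤1 1<E = absurd
        (+-pos-nonneg (+-pos-nonneg (+-pos-nonneg
          (*-positive (pos 1<E) (+-pos-nonneg (*-positive 0<φ (0<suc r)) (⌜⌝-nonneg q′)))
          (⌜⌝-nonneg q′))
          (*-nonneg (<⇒≤ 0<φ) (nonneg (⌜⌝-mono-≤ k≤q))))
          (*-nonneg (<⇒≤ 0<φ) (nonneg n≤k)))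
        (trans (solve 4 (λ φ q Q k →
            (q :- φ :* Q :- con 1ℤ) :* (φ :* q :+ Q) :+ Q :+ φ :* (q :- k) :+ φ :* (k :- (q :* q :- q :* Q :- Q :* Q))
              := (:- (q :* Q)) :* (φ :* φ :- (φ :+ con 1ℤ))) refl φ q Q′ ⌜ k ⌝)
          (trans (*-congˡ G≈0) (solve 1 (λ x → x :* con 0ℤ := con 0ℤ) refl _)))

      m+1≤ : suc m · u ≤ ((2 · 1#) * q + Q′ - 1#) * u
      m+1≤ = ≤-respˡ (sym (·≈* (suc m) u)) (≤-respˡ (*-comm u ⌜ suc m ⌝) (≤-respʳ (*-comm u _) (*-monoˡ-≤ (<⇒≤ 0<u)
        (≤-respʳ (trans (+-congˡ (trans (⌜⌝-+ (r ℕ.+ r) q′) (+-congʳ (⌜⌝-+ r r))))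
          (solve 2 (λ r Q → con 1ℤ :+ (r :+ r :+ Q) := con (+ 2) :* (con 1ℤ :+ r) :+ Q :- con 1ℤ) refl ⌜ r ⌝ Q′))
          (⌜⌝-mono-≤ (s≤s m≤))))))

      0<W : 0# < W
      0<W = +-pos-nonneg (*-positive (0<suc 1) 0<φ) (*-nonneg (<⇒≤ 0<2-φ) (nonneg E≤1))

      main : √5 * (((2 · 1#) * q + Q′ - 1#) * u) < √5 * bound
      main = by-pos (*-positive 0<v 0<W) (trans
        (+-cong (trans (solve 2 (λ s i → s :* (con 1ℤ :+ con (+ 2) :* i) := s :+ con (+ 2) :* (s :* i)) refl √5 _)
                  (+-congˡ (*-congˡ (x*inv≈1 √5 0<√5))))
                (-‿cong (*-congˡ (*-congˡ ratio))))
        (trans (+-cong (+-congʳ √5≈2φ-1) (-‿cong (*-congʳ √5≈2φ-1)))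
        (trans (+-congʳ (trans (solve 1 (λ φ → con (+ 2) :* φ :- con 1ℤ :+ con (+ 2) :* con 1ℤ := (con (+ 2) :* φ :+ con 1ℤ) :* con 1ℤ) refl φ)
            (*-congˡ (sym (trans (+-congʳ (*-congˡ (sym ratio))) q*u+Q′*v≈1)))))
        (trans (solve 4 (λ φ q Q v →
            (con (+ 2) :* φ :+ con 1ℤ) :* (q :* (φ :* v) :+ Q :* v)
              :- (con (+ 2) :* φ :- con 1ℤ) :* ((con (+ 2) :* q :+ Q :- con 1ℤ) :* (φ :* v))
            := v :* (con (+ 2) :* φ :+ (con (+ 2) :- φ) :* (con 1ℤ :- (q :- φ :* Q)))
               :+ v :* (con (+ 2) :- con (+ 2) :* q :- Q) :* (φ :* φ :- (φ :+ con 1ℤ))) refl φ q Q′ v)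
        (trans (+-congˡ (*-congˡ G≈0)) (solve 2 (λ x y → x :+ y :* con 0ℤ := x) refl _ _))))))

    -- `q′ ≥ 1` makes every further step increase `q`. The initial basis may have `q′ = 0`, so
    -- `grow` takes one step before counting.
    Grown : ℕ → ℕ → Set _
    Grown k n = Σ (Basis θ φ) λ basis → NormBounded k basis × 1 ℕ.≤ Basis.q′ basis × n ℕ.≤ suc (Basis.r basis)

    grow : ∀ {k} (basis : Basis θ φ) → NormBounded k basis → ∀ n → Grown k n
    grow {k} basis bounded zero    = golden-step basis , NormBounded-step {k} basis bounded , s≤s z≤n , z≤n
    grow {k} basis bounded (suc n) = next (grow {k} basis bounded n)
      where
      next : Grown k n → Grown k (suc n)
      next (basis , bounded , 1≤q′ , n≤q) = golden-step basis , NormBounded-step {k} basis bounded , s≤s z≤n ,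
        s≤s (ℕₚ.≤-trans n≤q (ℕₚ.≤-trans (ℕₚ.≤-reflexive (ℕₚ.+-comm 1 _)) (ℕₚ.+-monoʳ-≤ (Basis.r basis) 1≤q′)))

    Covering : ℕ → ℕ → Set _
    Covering k m = Σ (Basis θ φ) λ basis → NormBounded k basis × k ℕ.≤ suc (Basis.r basis) ×
      Basis.r basis ℕ.+ Basis.q′ basis ℕ.≤ m × m ℕ.≤ Basis.r basis ℕ.+ Basis.r basis ℕ.+ Basis.q′ basis

    -- A golden step turns `(q, q′)` into `(q + q′, q)`, so the next range begins at `2q + q′ - 1`,
    -- immediately after the end of the current one: the ranges leave no index uncovered.
    covering-suc : ∀ {k m} → Covering k m → Covering k (suc m)
    covering-suc {k} {m} (basis , bounded , k≤q , ≤m , m≤) = decide (m ℕₚ.<? r ℕ.+ r ℕ.+ q′)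
      where
      open Basis basis
      decide : _ → Covering k (suc m)
      decide (yes m<) = basis , bounded , k≤q , ℕₚ.m≤n⇒m≤1+n ≤m , m<
      decide (no m≮)  = golden-step basis , NormBounded-step {k} basis bounded ,
        ℕₚ.≤-trans k≤q (s≤s (ℕₚ.m≤m+n r q′)) , ℕₚ.≤-reflexive next≡ ,
        ℕₚ.≤-trans (ℕₚ.≤-reflexive (≡.sym next≡)) (ℕₚ.+-monoˡ-≤ (suc r) (ℕₚ.m≤m+n (r ℕ.+ q′) _))
        where
        m≡ : r ℕ.+ r ℕ.+ q′ ≡ m
        m≡ = ℕₚ.≤-antisym (ℕₚ.≮⇒≥ m≮) m≤
        next≡ : r ℕ.+ q′ ℕ.+ suc r ≡ suc m
        next≡ = ≡.trans (ℕₚ.+-suc (r ℕ.+ q′) r) (≡.cong suc (≡.trans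
          (≡.trans (ℕₚ.+-assoc r q′ r) (≡.trans (≡.cong (r ℕ.+_) (ℕₚ.+-comm q′ r)) (≡.sym (ℕₚ.+-assoc r r q′)))) m≡))

    SmallGaps : ℕ → Set _
    SmallGaps M = ∀ m → M ℕ.≤ m → ∃[ d ] IsLargestGap θ m d × suc m · d < bound

    golden⇒small-gaps : θ ≍ φ → ∃[ M ] 0 ℕ.< M × SmallGaps M
    golden⇒small-gaps θ≍φ = from-norm (norm-bounded basis₀)
      where
      basis₀ = golden-basis θ≍φ
      from-norm : ∃[ k ] NormBounded k basis₀ → ∃[ M ] 0 ℕ.< M × SmallGaps M
      from-norm (k , bounded₀) = from-grown (grow {k} basis₀ bounded₀ k)
        where
        from-grown : Grown k k → ∃[ M ] 0 ℕ.< M × SmallGaps M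
        from-grown (basis , bounded , 1≤q′ , k≤q) = M , ℕₚ.≤-trans 1≤q′ (ℕₚ.m≤n+m q′ r) ,
            λ m M≤m → conclude (≡.subst (Covering k) (ℕₚ.m∸n+n≡m M≤m) (cover (m ℕ.∸ M)))
          where
          open Basis basis using (r; q′)
          M = r ℕ.+ q′
          cover : ∀ i → Covering k (i ℕ.+ M)
          cover zero    = basis , bounded , k≤q , ℕₚ.≤-refl , ℕₚ.+-monoˡ-≤ q′ (ℕₚ.m≤m+n r r)
          cover (suc i) = covering-suc (cover i)
          conclude : ∀ {m} → Covering k m → ∃[ d ] IsLargestGap θ m d × suc m · d < bound
          conclude (basis , bounded , k≤q , ≤m , m≤) = BasisProperties.u basis ,
            BasisProperties.largest-gap basis ≤m m≤ v≤u , below-bound {k} basis bounded k≤q m≤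
            where
            open BasisProperties basis using (0<v; ratio; v)
            v≤u = by-nonneg (<⇒≤ (*-positive 0<φ-1 0<v)) (trans (+-congʳ ratio)
              (solve 2 (λ φ v → φ :* v :- v := (φ :- con 1ℤ) :* v) refl φ v))

-- Convergence of an expansion given by complete quotients

module Convergence {c ℓ₁ ℓ₂} (R : Reals c ℓ₁ ℓ₂) where

  open RealTheory R
  open OrderedField R
  open Gaps R
  open Steps R
  open ContinuedFraction

  -- This is `|w e| ≤ 2`; with `w = n + 1` it is the rate of convergence proved below.
  Bounded : ℝ → ℝ → Set _
  Bounded w e = w * e ≤ 2 · 1# × w * (- e) ≤ 2 · 1#

  Bounded-neg : ∀ {w e} → Bounded w e → Bounded w (- e)
  Bounded-neg {w} {e} (e≤ , -e≤) = -e≤ , ≤-respˡ (solve 2 (λ w e → w :* e := w :* (:- :- e)) refl w e) e≤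

  -- Arguing by contradiction avoids a case split on the sign of `e`: from `2 < w′ e` follows
  -- `e > 0`, and then `w′ e ≤ w k e = w f ≤ 2`.
  shrink-≤ : ∀ {w w′ k e f} → 0# ≤ w′ → w′ ≤ w * k → k * e ≈ f → w * f ≤ 2 · 1# → w′ * e ≤ 2 · 1#
  shrink-≤ {w} {w′} {k} {e} {f} 0≤w′ w′≤wk ke≈f wf≤2 2<w′e = wf≤2 (<-≤-trans 2<w′e (by-nonneg
    (*-nonneg (nonneg w′≤wk) (<⇒≤ (*-cancelˡ-pos 0≤w′ (<-trans (0<suc 1) 2<w′e))))
    (trans (+-congʳ (*-congˡ (sym ke≈f)))
      (solve 4 (λ w w′ k e → w :* (k :* e) :- w′ :* e := (w :* k :- w′) :* e) refl w w′ k e))))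

  shrink : ∀ {w w′ k e f} → 0# ≤ w′ → w′ ≤ w * k → k * e ≈ f → Bounded w f → Bounded w′ e
  shrink {w} {w′} {k} {e} {f} 0≤w′ w′≤wk ke≈f (f≤ , -f≤) = shrink-≤ 0≤w′ w′≤wk ke≈f f≤ ,
    shrink-≤ 0≤w′ w′≤wk (trans (solve 2 (λ k e → k :* (:- e) := :- (k :* e)) refl k e) (-‿cong ke≈f)) -f≤

  1≤* : ∀ {x y} → 1# ≤ x → 1# ≤ y → 1# ≤ x * y
  1≤* {x} {y} 1≤x 1≤y = by-nonneg (+-nonneg (*-nonneg (nonneg 1≤x) (<⇒≤ (<-≤-trans 0<1 1≤y))) (nonneg 1≤y))
    (solve 2 (λ x y → x :* y :- con 1ℤ := (x :- con 1ℤ) :* y :+ (y :- con 1ℤ)) refl x y)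

  module _ (a : ContinuedFraction) (X : ℕ → ℝ) (1<X : ∀ i → 1# < X i)
    (X-rec : ∀ i → (X i - fromℤ (quotient a (suc i))) * X (suc i) ≈ 1#) where

    private
      S : ℕ → ℕ → ℝ
      S i n = proj₁ (segment a i n)

      E : ℕ → ℕ → ℝ
      E i n = X i - S i n

      K : ℕ → ℕ → ℝ
      K i n = X i * S i n

      1≤X : ∀ i → 1# ≤ X i
      1≤X i = <⇒≤ (1<X i)

      -- x - s = 1/x′ - 1/s′
      error-rec : ∀ {b x x′ s′} (0<s′ : 0# < s′) → (x - b) * x′ ≈ 1# →
                  (x′ * s′) * (x - (b + inv s′ 0<s′)) ≈ - (x′ - s′)
      error-rec {b} {x} {x′} {s′} 0<s′ eq = trans
        (solve 5 (λ b x x′ s i → x′ :* s :* (x :- (b :+ i)) := s :* ((x :- b) :* x′) :- x′ :* (s :* i)) refl b x x′ s′ _)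
        (trans (+-cong (*-congˡ eq) (-‿cong (*-congˡ (x*inv≈1 s′ 0<s′))))
          (solve 2 (λ x s → s :* con 1ℤ :- x :* con 1ℤ := :- (x :- s)) refl x′ s′))

      E-rec : ∀ i n → K (suc i) n * E i (suc n) ≈ - E (suc i) n
      E-rec i n = error-rec (proj₂ (segment a (suc i) n)) (X-rec i)

      E-rec² : ∀ i n → (K (suc i) (suc n) * K (suc (suc i)) n) * E i (suc (suc n)) ≈ E (suc (suc i)) n
      E-rec² i n = trans
        (solve 3 (λ k l e → k :* l :* e := l :* (k :* e)) refl (K (suc i) (suc n)) (K (suc (suc i)) n) (E i (suc (suc n))))
        (trans (*-congˡ (E-rec i (suc n)))
        (trans (solve 2 (λ l e → l :* (:- e) := :- (l :* e)) refl (K (suc (suc i)) n) (E (suc i) (suc n)))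
        (trans (-‿cong (E-rec (suc i) n)) (solve 1 (λ e → :- :- e := e) refl (E (suc (suc i)) n)))))

      2≤ : ∀ {b x x′} → 1# ≤ b → 1# ≤ x′ → (x - b) * x′ ≈ 1# → 2 · 1# ≤ x * x′
      2≤ {b} {x} {x′} 1≤b 1≤x′ eq = by-nonneg (nonneg (1≤* 1≤b 1≤x′))
        (trans (solve 3 (λ b x x′ → x :* x′ :- con (+ 2) := b :* x′ :- con (+ 2) :+ (x :- b) :* x′) refl b x x′)
        (trans (+-congˡ eq) (solve 2 (λ b x′ → b :* x′ :- con (+ 2) :+ con 1ℤ := b :* x′ :- con 1ℤ) refl b x′)))

      -- One step of the recursion may contract arbitrarily little, but two steps cannot:
      -- `X i X (i + 1) = b X (i + 1) + 1 ≥ 2`, where `b ≥ 1` is the quotient, and the same holds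
      -- for the segments.
      4≤K² : ∀ i n → 4 · 1# ≤ K i (suc n) * K (suc i) n
      4≤K² i n = by-nonneg
        (+-nonneg (*-nonneg (nonneg XX) (<⇒≤ (<-≤-trans (0<suc 1) SS))) (*-nonneg (<⇒≤ (0<suc 1)) (nonneg SS)))
        (solve 4 (λ x s x′ s′ → x :* s :* (x′ :* s′) :- con (+ 4)
                     := (x :* x′ :- con (+ 2)) :* (s :* s′) :+ con (+ 2) :* (s :* s′ :- con (+ 2)))
          refl (X i) (S i (suc n)) (X (suc i)) (S (suc i) n))
        where
        1≤A = 1≤fromℤ (positive a i)
        XX : 2 · 1# ≤ X i * X (suc i)
        XX = 2≤ 1≤A (1≤X (suc i)) (X-rec i)
        SS : 2 · 1# ≤ S i (suc n) * S (suc i) n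
        SS = 2≤ 1≤A (1≤segment a (suc i) n) (trans (*-congʳ
          (solve 2 (λ b i → b :+ i :- b := i) refl (fromℤ (quotient a (suc i))) _)) (inv*x≈1 _ (proj₂ (segment a (suc i) n))))

      E₀ : ∀ i → Bounded (2 · 1#) (E i 0)
      E₀ i = by-nonneg (*-nonneg (<⇒≤ (0<suc 1)) (nonneg e≤1))
          (solve 1 (λ e → con (+ 2) :- con (+ 2) :* e := con (+ 2) :* (con 1ℤ :- e)) refl (E i 0)) ,
        by-nonneg (+-nonneg (<⇒≤ (0<suc 1)) (*-nonneg (<⇒≤ (0<suc 1)) 0≤e))
          (solve 1 (λ e → con (+ 2) :- con (+ 2) :* (:- e) := con (+ 2) :+ con (+ 2) :* e) refl (E i 0))
        where
        0≤e : 0# ≤ E i 0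
        0≤e = <⇒≤ (*-cancelˡ-pos (<⇒≤ (<-trans 0<1 (1<X (suc i)))) (<-respʳ-≈ (sym (trans (*-comm _ _) (X-rec i))) 0<1))
        e≤1 : E i 0 ≤ 1#
        e≤1 = by-nonneg (*-nonneg 0≤e (nonneg (1≤X (suc i))))
          (trans (+-congʳ (sym (X-rec i))) (solve 2 (λ e x → e :* x :- e := e :* (x :- con 1ℤ)) refl (E i 0) (X (suc i))))

      ≤*K : ∀ {w} i n → 0# ≤ w → w ≤ w * K i n
      ≤*K {w} i n 0≤w = ≤-respˡ (*-identityʳ w) (*-monoˡ-≤ 0≤w (1≤* (1≤X i) (1≤segment a i n)))

      E-bounded : ∀ i n → Bounded ⌜ suc n ⌝ (E i n)
      E-bounded i 0 = shrink (⌜⌝-nonneg 1) (≤-respʳ (sym (*-identityʳ _)) (⌜⌝-mono-≤ {1} {2} (s≤s z≤n))) (*-identityˡ _) (E₀ i)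
      E-bounded i 1 = shrink (⌜⌝-nonneg 2) (≤*K (suc i) 0 (⌜⌝-nonneg 2)) (E-rec i 0) (Bounded-neg (E₀ (suc i)))
      -- The decay is geometric, but a linear weight is enough for convergence: two steps gain a
      -- factor 4, and `4 (n + 1) ≥ n + 3`.
      E-bounded i (suc (suc n)) = shrink (⌜⌝-nonneg (3 ℕ.+ n))
        (≤-trans (by-nonneg (+-nonneg (<⇒≤ 0<1) (*-nonneg (⌜⌝-nonneg 3) (⌜⌝-nonneg n)))
                   (solve 1 (λ n → (con 1ℤ :+ n) :* con (+ 4) :- (con 1ℤ :+ (con 1ℤ :+ (con 1ℤ :+ n))) := con 1ℤ :+ con (+ 3) :* n) refl ⌜ n ⌝))
                 (*-monoˡ-≤ (⌜⌝-nonneg (suc n)) (4≤K² (suc i) n)))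
        (E-rec² i n) (E-bounded (suc (suc i)) n)

    has-expansion : ∀ {x} → (x - fromℤ (quotient a 0)) * X 0 ≈ 1# → x HasExpansion a
    has-expansion {x} eq ε 0<ε = from-bound (exceed (2 · 1#) 0<ε)
      where
      e-bounded : ∀ n → Bounded ⌜ suc n ⌝ (x - convergent a (suc n))
      e-bounded n = shrink (⌜⌝-nonneg (suc n)) (≤*K 0 n (⌜⌝-nonneg (suc n)))
        (error-rec (proj₂ (segment a 0 n)) eq) (Bounded-neg (E-bounded 0 n))

      small : ∀ {N n e} → 2 · 1# < ⌜ N ⌝ * ε → N ℕ.≤ suc n → ⌜ suc n ⌝ * e ≤ 2 · 1# → e < ε
      small {N} {n} 2<Nε N≤n e≤ = *-cancelˡ-< (⌜⌝-nonneg (suc n)) (≤-<-trans e≤ (<-≤-trans 2<Nε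
        (≤-respˡ (*-comm ε ⌜ N ⌝) (≤-respʳ (*-comm ε ⌜ suc n ⌝) (*-monoˡ-≤ (<⇒≤ 0<ε) (⌜⌝-mono-≤ N≤n))))))

      from-bound : ∃[ N ] 2 · 1# < ⌜ N ⌝ * ε → ∃[ N ] (∀ n → N ℕ.≤ n → Within ε (convergent a n) x)
      from-bound (N , 2<Nε) = suc N , within
        where
        within : ∀ n → suc N ℕ.≤ n → Within ε (convergent a n) x
        within (suc n) (s≤s N≤n) =
          by-pos (pos (small 2<Nε (ℕₚ.m≤n⇒m≤1+n N≤n) (proj₂ (e-bounded n))))
            (solve 3 (λ x c e → x :+ e :- c := e :- :- (x :- c)) refl x (convergent a (suc n)) ε) ,
          by-pos (pos (small 2<Nε (ℕₚ.m≤n⇒m≤1+n N≤n) (proj₁ (e-bounded n))))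
            (solve 3 (λ x c e → c :+ e :- x := e :- (x :- c)) refl x (convergent a (suc n)) ε)

-- The expansion of an irrational number

module Expansion {c ℓ₁ ℓ₂} (R : Reals c ℓ₁ ℓ₂) where

  open RealTheory R
  open OrderedField R
  open Gaps R
  open Steps R
  open Convergence R
  open ContinuedFraction

  -- If qθ is close to an integer, then the kθ with k ≤ m lie within w = 1/(4q) of
  -- multiples of 1/q, so they miss (w, 3w).
  rational-gap : ∀ {θ} m k (p : ℤ) → let q = ⌜ suc k ⌝ ; w = inv (4 · 1# * q) (*-positive (0<suc 3) (0<suc k)) in
    ∀ {ε} → ⌜ m ⌝ * ε ≤ w * q → let e = q * θ - fromℤ p in e ≤ ε → - e ≤ ε →
    Gap θ m (2 · 1# * w)
  rational-gap {θ} m k p {ε} mε≤ e≤ε -e≤ε = I , avoids , solve 1 (λ w → con (+ 2) :* w := con (+ 3) :* w :- w) refl w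
    where
    q = ⌜ suc k ⌝
    0<4q = *-positive (0<suc 3) (0<suc k)
    w = inv (4 · 1# * q) 0<4q
    0<w = inv-positive (4 · 1# * q) 0<4q
    e = q * θ - fromℤ p
    4qw≈1 : 4 · 1# * q * w ≈ 1#
    4qw≈1 = x*inv≈1 _ 0<4q
    I : Interval
    I = record { left = w ; right = 3 · 1# * w ; leftEnd = excluded ; rightEnd = excluded
               ; left≤right = <⇒≤ (by-pos (*-positive (0<suc 1) 0<w) (solve 1 (λ w → con (+ 3) :* w :- w := con (+ 2) :* w) refl w)) }

    error : ∀ {j d} → j ℕ.≤ m → d ≤ ε → - d ≤ ε → ⌜ j ⌝ * d ≤ w * q
    error {j} {d} j≤m d≤ε -d≤ε = ≤-trans (*-monoˡ-≤ (⌜⌝-nonneg j) d≤ε) (≤-trans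
      (≤-respˡ (*-comm ε _) (≤-respʳ (*-comm ε _) (*-monoˡ-≤ 0≤ε (⌜⌝-mono-≤ j≤m)))) mε≤)
      where
      0≤ε : 0# ≤ ε
      0≤ε ε<0 = absurd (+-pos-nonneg (+-pos-nonneg (*-positive (0<suc 1) (pos ε<0)) (nonneg d≤ε)) (nonneg -d≤ε))
        (solve 2 (λ ε d → con (+ 2) :* (con 0ℤ :- ε) :+ (ε :- d) :+ (ε :- :- d) := con 0ℤ) refl ε d)

    avoids : Avoids I θ m
    avoids {y} (w<y , y<3w) z j j≤m y+z≈jθ = cases (fromℤ≤0⊎1≤ i)
      where
      -- The integer `i` equals `q y - j e`. Now `q y` lies strictly between 1/4 and 3/4, and
      -- `|j e| ≤ w q = 1/4`, so `i` would lie strictly between 0 and 1.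
      i = + j ℤ.* p ℤ.- z ℤ.* +[1+ k ]
      i≈ : q * y - ⌜ j ⌝ * e ≈ fromℤ i
      i≈ = sym (trans (fromℤ-det (+ j) p z +[1+ k ])
        (trans (solve 6 (λ J P Z q y t → J :* P :- Z :* q := q :* y :- J :* (q :* t :- P) :- q :* (y :+ Z :- J :* t)) refl ⌜ j ⌝ (fromℤ p) (fromℤ z) q y θ)
        (trans (+-congˡ (-‿cong (*-congˡ (diff≈0 (trans y+z≈jθ (·≈* j θ))))))
          (solve 2 (λ x q → x :- q :* con 0ℤ := x) refl _ q))))
      cases : fromℤ i ≤ 0# ⊎ 1# ≤ fromℤ i → ⊥
      cases (inj₁ i≤0) = absurd (+-pos-nonneg (+-pos-nonneg (*-positive (0<suc k) (pos w<y)) (nonneg i≤0)) (nonneg (error j≤m e≤ε -e≤ε)))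
        (trans (solve 5 (λ q w y je i → q :* (y :- w) :+ (con 0ℤ :- i) :+ (w :* q :- je) := q :* y :- je :- i) refl q w y (⌜ j ⌝ * e) (fromℤ i))
          (diff≈0 i≈))
      cases (inj₂ 1≤i) = absurd (+-pos-nonneg (+-pos-nonneg (*-positive (0<suc k) (pos y<3w)) (nonneg 1≤i))
          (nonneg (error j≤m -e≤ε (≤-respˡ (solve 1 (λ e → e := :- :- e) refl e) e≤ε))))
        (trans (solve 5 (λ q w y je i → q :* (con (+ 3) :* w :- y) :+ (i :- con 1ℤ) :+ (w :* q :- je) := (i :- con 1ℤ) :+ (con (+ 4) :* q :* w) :- (q :* y :+ je)) refl q w y (⌜ j ⌝ * (- e)) (fromℤ i))
        (trans (+-cong (+-congˡ 4qw≈1) (-‿cong (trans (solve 3 (λ a j e → a :+ j :* (:- e) := a :- j :* e) refl (q * y) ⌜ j ⌝ e) i≈)))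
          (solve 1 (λ i → i :- con 1ℤ :+ con 1ℤ :- i := con 0ℤ) refl (fromℤ i))))

  -- A positive form of irrationality: it decides the sign of each `qθ - p` instead of merely
  -- denying that it vanishes, and these decisions are what the floors consume.
  Irrational : ℝ → Set _
  Irrational θ = ∀ k p → let e = ⌜ suc k ⌝ * θ - fromℤ p in 0# < e ⊎ e < 0#

  Irrational-± : ∀ {t θ} → t ≈ θ ⊎ t ≈ - θ → Irrational θ → Irrational t
  Irrational-± (inj₁ t≈θ) irr k p with irr k p
  ... | inj₁ 0<e = inj₁ (<-respʳ-≈ (+-congʳ (*-congˡ (sym t≈θ))) 0<e)
  ... | inj₂ e<0 = inj₂ (<-respˡ-≈ (+-congʳ (*-congˡ (sym t≈θ))) e<0)
  Irrational-± {t} {θ} (inj₂ t≈-θ) irr k p with irr k (ℤ.- p)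
  ... | inj₁ 0<e = inj₂ (by-pos 0<e (trans (+-congˡ (-‿cong (+-congʳ (*-congˡ t≈-θ))))
          (trans (solve 3 (λ q t p → con 0ℤ :- (q :* (:- t) :- p) := q :* t :- :- p) refl ⌜ suc k ⌝ θ (fromℤ p))
            (+-congˡ (-‿cong (sym (fromℤ-neg p)))))))
  ... | inj₂ e<0 = inj₁ (by-pos (pos e<0) (trans (+-congʳ (+-congʳ (*-congˡ t≈-θ)))
          (trans (solve 3 (λ q t p → q :* (:- t) :- p :- con 0ℤ := con 0ℤ :- (q :* t :- :- p)) refl ⌜ suc k ⌝ θ (fromℤ p))
            (+-congˡ (-‿cong (+-congˡ (-‿cong (sym (fromℤ-neg p)))))))))

  State : ℝ → Set _
  State θ = Σ ℝ λ x → 1# < x × Basis θ x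

  1<inv : ∀ {x} (0<x : 0# < x) → x < 1# → 1# < inv x 0<x
  1<inv {x} 0<x x<1 = *-cancelˡ-< (<⇒≤ 0<x) (<-respˡ-≈ (sym (*-identityʳ x)) (<-respʳ-≈ (sym (x*inv≈1 x 0<x)) x<1))

  module _ {θ : ℝ} (irr : Irrational θ) where

    -- With `K = k + 1`, the sign of `x - K` is that of `v (x - K) = u - K v = (K q + q′) t - (p′ +
    -- K p)`, an integer combination covered by irrationality.
    compare : ∀ {x} → Basis θ x → ∀ k → x < ⌜ suc k ⌝ ⊎ ⌜ suc k ⌝ < x
    compare {x} basis k = Sum.swap (Sum.map
        (λ 0<e → by-pos (*-cancelˡ-pos (<⇒≤ 0<v) (<-respʳ-≈ e≈ 0<e)) refl)
        (λ e<0 → by-pos (*-cancelˡ-pos (<⇒≤ 0<v) (<-respʳ-≈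
          (trans (+-congˡ (-‿cong e≈)) (solve 3 (λ v x k → con 0ℤ :- v :* (x :- k) := v :* (k :- x)) refl v x ⌜ suc k ⌝)) (pos e<0))) refl)
        (Irrational-± t≈±θ irr (r ℕ.+ k ℕ.* suc r ℕ.+ q′) (p′ ℤ.+ +[1+ k ] ℤ.* p)))
      where
      open BasisProperties basis
      e≈ : ⌜ suc (r ℕ.+ k ℕ.* suc r ℕ.+ q′) ⌝ * t - fromℤ (p′ ℤ.+ +[1+ k ] ℤ.* p) ≈ v * (x - ⌜ suc k ⌝)
      e≈ = trans (+-cong (*-congʳ (trans (⌜⌝-+ (suc k ℕ.* suc r) q′) (+-congʳ (⌜⌝-* (suc k) (suc r)))))
                   (-‿cong (trans (fromℤ-+ p′ (+[1+ k ] ℤ.* p)) (+-congˡ (fromℤ-* +[1+ k ] p)))))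
        (trans (solve 6 (λ k q Q t P P′ → (k :* q :+ Q) :* t :- (P′ :+ k :* P) := Q :* t :- P′ :- k :* (P :- q :* t)) refl ⌜ suc k ⌝ q Q′ t P P′)
        (trans (+-congʳ ratio) (solve 3 (λ x v k → x :* v :- k :* v := v :* (x :- k)) refl x v ⌜ suc k ⌝)))

    Floor : ℝ → ℕ → Set _
    Floor x a = ⌜ a ⌝ < x × x < 1# + ⌜ a ⌝

    quotient-of : (s : State θ) → ∃[ a ] Floor (proj₁ s) (suc a)
    quotient-of (x , 1<x , basis) = positive-floor (floor (<-trans 0<1 1<x) (compare basis))
      where
      positive-floor : ∃[ a ] Floor x a → ∃[ a ] Floor x (suc a)
      positive-floor (zero  , _ , x<1) = contradiction (<-respʳ-≈ (+-identityʳ 1#) x<1) (<⇒≤ 1<x)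
      positive-floor (suc a , a≤x , x<) = a , a≤x , x<

    next-with : (s : State θ) → ∃[ a ] Floor (proj₁ s) (suc a) → State θ
    next-with (x , 1<x , basis) (a , a<x , x<1+a) =
      inv (x - ⌜ suc a ⌝) (pos a<x) , 1<inv (pos a<x) (by-pos (pos x<1+a) (solve 2 (λ x a → con 1ℤ :- (x :- a) := con 1ℤ :+ a :- x) refl x ⌜ suc a ⌝)) ,
      step basis a (inv-positive _ (pos a<x)) (x*inv≈1 _ (pos a<x))

    integer-part : ∃[ a ] fromℤ a < θ × θ < 1# + fromℤ a
    integer-part = from-bound (archimedean (- θ))
      where
      from-bound : ∃[ n ] - θ < ⌜ n ⌝ → ∃[ a ] fromℤ a < θ × θ < 1# + fromℤ a
      -- The shift by `n` makes the number positive, as `floor` demands; it is subtracted again from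
      -- the result.
      from-bound (n , -θ<n) = from-floor (floor {⌜ n ⌝ + θ}
          (<-respʳ-≈ (solve 2 (λ n θ → n :- :- θ := n :+ θ) refl ⌜ n ⌝ θ) (pos -θ<n)) compare-θ)
        where
        shift : ∀ k → fromℤ (+ k ℤ.- + n) ≈ ⌜ k ⌝ - ⌜ n ⌝
        shift k = fromℤ-minus (+ k) (+ n)
        e≈ : ∀ k → ⌜ 1 ⌝ * θ - fromℤ (+ suc k ℤ.- + n) ≈ ⌜ n ⌝ + θ - ⌜ suc k ⌝
        e≈ k = trans (+-congˡ (-‿cong (shift (suc k))))
          (solve 3 (λ n θ k → (con 1ℤ :+ con 0ℤ) :* θ :- (k :- n) := n :+ θ :- k) refl ⌜ n ⌝ θ ⌜ suc k ⌝)
        compare-θ : ∀ k → ⌜ n ⌝ + θ < ⌜ suc k ⌝ ⊎ ⌜ suc k ⌝ < ⌜ n ⌝ + θ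
        compare-θ k = Sum.swap (Sum.map
          (λ 0<e → by-pos (<-respʳ-≈ (e≈ k) 0<e) refl)
          (λ e<0 → by-pos (pos e<0) (trans (solve 2 (λ k x → k :- x := con 0ℤ :- (x :- k)) refl ⌜ suc k ⌝ (⌜ n ⌝ + θ)) (+-congˡ (-‿cong (sym (e≈ k))))))
          (irr 0 (+ suc k ℤ.- + n)))
        from-floor : ∃[ k ] Floor (⌜ n ⌝ + θ) k → ∃[ a ] fromℤ a < θ × θ < 1# + fromℤ a
        from-floor (k , k< , <k+1) = + k ℤ.- + n ,
          by-pos (pos k<) (trans (+-congˡ (-‿cong (shift k))) (solve 3 (λ k n θ → θ :- (k :- n) := n :+ θ :- k) refl ⌜ k ⌝ ⌜ n ⌝ θ)) ,
          by-pos (pos <k+1) (trans (+-congʳ (+-congˡ (shift k))) (solve 3 (λ k n θ → con 1ℤ :+ (k :- n) :- θ := con 1ℤ :+ k :- (n :+ θ)) refl ⌜ k ⌝ ⌜ n ⌝ θ))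

    a₀ : ℤ
    a₀ = proj₁ integer-part

    0<θ-a₀ : 0# < θ - fromℤ a₀
    0<θ-a₀ = pos (proj₁ (proj₂ integer-part))

    state : ℕ → State θ
    state zero    = inv _ 0<θ-a₀ ,
      1<inv 0<θ-a₀ (by-pos (pos (proj₂ (proj₂ integer-part))) (solve 2 (λ θ a → con 1ℤ :- (θ :- a) := con 1ℤ :+ a :- θ) refl θ (fromℤ a₀))) ,
      first-basis {a = a₀} (inv-positive _ 0<θ-a₀) (x*inv≈1 _ 0<θ-a₀)
    state (suc i) = next-with (state i) (quotient-of (state i))

    a₁₊ : ℕ → ℕ
    a₁₊ i = proj₁ (quotient-of (state i))

    expansion : ContinuedFraction
    expansion = record { quotient = λ { zero → a₀ ; (suc i) → +[1+ a₁₊ i ] } ; positive = λ i → ℤ.+<+ (s≤s z≤n) }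

    θ-expansion : θ HasExpansion expansion
    θ-expansion = has-expansion expansion (λ i → proj₁ (state i)) (λ i → proj₁ (proj₂ (state i)))
      (λ i → x*inv≈1 _ (pos (proj₁ (proj₂ (quotient-of (state i))))))
      (x*inv≈1 _ 0<θ-a₀)

    basis-of : ∀ i → Basis θ (proj₁ (state i))
    basis-of i = proj₂ (proj₂ (state i))

    -- From the second basis on, `q′` is an earlier denominator and so at least 1; hence the
    -- denominators strictly increase from there.
    r-grows : ∀ i → i ℕ.≤ Basis.r (basis-of (suc i))
    r-grows zero    = z≤n
    r-grows (suc i) = ℕₚ.≤-trans (s≤s (r-grows i)) (ℕₚ.≤-trans
      (ℕₚ.≤-reflexive (ℕₚ.+-comm 1 r))
      (ℕₚ.+-monoʳ-≤ r (ℕₚ.≤-trans (s≤s z≤n) (ℕₚ.m≤n+m (suc (Basis.r (basis-of i))) (a₁₊ (suc i) ℕ.* suc r)))))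
      where r = Basis.r (basis-of (suc i))

-- Small gaps force a golden tail

module Converse {c ℓ₁ ℓ₂} (R : Reals c ℓ₁ ℓ₂)
  (√5 : Reals.ℝ R) (0<√5 : Reals._<_ R (Reals.0# R) √5)
  (√5²≈5 : Reals._≈_ R (Reals._*_ R √5 √5) (Reals._·_ R 5 (Reals.1# R))) where

  open RealTheory R
  open OrderedField R
  open Gaps R
  open Steps R
  open Convergence R
  open Expansion R
  open Golden R √5 0<√5 √5²≈5

  -- The squares are 121 and 125. The inequality amounts to `2/√5 < 10/11`, that is
  -- `bound < 21/11 = 2 - 1/11`, the margin used for denominators `q ≥ 11`.
  11<5√5 : 11 · 1# < 5 · 1# * √5
  11<5√5 = by-pos (*-cancelˡ-pos {5 · 1# * √5 + 11 · 1#}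
      (<⇒≤ (+-positive (*-positive (0<suc 4) 0<√5) (0<suc 10)))
      (<-respʳ-≈ (sym (trans
        (solve 1 (λ s → (con (+ 5) :* s :+ con (+ 11)) :* (con (+ 5) :* s :- con (+ 11)) := con (+ 25) :* (s :* s) :- con (+ 121)) refl √5)
        (trans (+-congʳ (*-congˡ √5²≈5)) (solve 0 (con (+ 25) :* con (+ 5) :- con (+ 121) := con (+ 4)) refl))))
        (0<suc 3))) refl

  11*bound<21 : 11 · 1# * bound < 21 · 1#
  11*bound<21 = by-pos (*-positive (*-positive (0<suc 1) (inv-positive √5 0<√5)) (pos 11<5√5))
    (sym (trans (solve 2 (λ s i → con (+ 2) :* i :* (con (+ 5) :* s :- con (+ 11)) := con (+ 10) :* (s :* i) :- con (+ 22) :* i) refl √5 _)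
      (trans (+-congʳ (*-congˡ (x*inv≈1 √5 0<√5)))
        (solve 1 (λ i → con (+ 10) :* con 1ℤ :- con (+ 22) :* i := con (+ 21) :- con (+ 11) :* (con 1ℤ :+ con (+ 2) :* i)) refl _))))

  bound<2 : bound < 2 · 1#
  bound<2 = *-cancelˡ-< (⌜⌝-nonneg 11) (<-trans 11*bound<21 (by-pos 0<1
    (solve 0 (con (+ 11) :* con (+ 2) :- con (+ 21) := con 1ℤ) refl)))

  module _ {θ : ℝ} {M : ℕ} (small : SmallGaps {θ} M) where

    gap-bound : ∀ {m x} → M ℕ.≤ m → Gap θ m x → ⌜ suc m ⌝ * x < bound
    gap-bound {m} {x} M≤m gap = from-supremum (small m M≤m)
      where
      from-supremum : ∃[ d ] IsLargestGap θ m d × suc m · d < bound → ⌜ suc m ⌝ * x < bound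
      from-supremum (d , (upper , _) , <bound) =
        ≤-<-trans (*-monoˡ-≤ (⌜⌝-nonneg (suc m)) (upper x gap)) (<-respˡ-≈ (·≈* (suc m) d) <bound)

    -- If `|qθ - p|` were below `ε = 1/(4m)`, then `rational-gap` would provide a gap `2w = 1/(2q)`
    -- at index `m`. As `m + 1 ≥ 4q`, its product with `m + 1` is at least 2, which exceeds `bound`.
    irrational : Irrational θ
    irrational k p = decide (<-cotrans 0<ε e) (<-cotrans -ε<0 e)
      where
      q = ⌜ suc k ⌝
      0<4q = *-positive (0<suc 3) (0<suc k)
      w = inv (4 · 1# * q) 0<4q
      0<w = inv-positive (4 · 1# * q) 0<4q
      e = q * θ - fromℤ p
      m′ = M ℕ.+ 4 ℕ.* suc k
      m = suc m′
      ε = inv ⌜ m ⌝ (0<suc m′) * (w * q)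
      0<ε : 0# < ε
      0<ε = *-positive (inv-positive _ (0<suc m′)) (*-positive 0<w (0<suc k))
      -ε<0 : - ε < 0#
      -ε<0 = by-pos 0<ε (solve 1 (λ ε → con 0ℤ :- :- ε := ε) refl ε)
      mε≈ : ⌜ m ⌝ * ε ≈ w * q
      mε≈ = trans (solve 3 (λ m i x → m :* (i :* x) := m :* i :* x) refl ⌜ m ⌝ _ (w * q))
        (trans (*-congʳ (x*inv≈1 ⌜ m ⌝ (0<suc m′))) (*-identityˡ _))
      4q≤m+1 : 4 · 1# * q ≤ ⌜ suc m ⌝
      4q≤m+1 = ≤-respˡ (⌜⌝-* 4 (suc k)) (⌜⌝-mono-≤ {4 ℕ.* suc k} (ℕₚ.m≤n⇒m≤1+n (ℕₚ.m≤n⇒m≤1+n (ℕₚ.m≤n+m _ M))))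
      -- Cotransitivity compares `e` with 0 only up to the tolerance `ε`; the sole undecided
      -- outcome, `- ε < e < ε`, is the one just excluded.
      decide : 0# < e ⊎ e < ε → - ε < e ⊎ e < 0# → 0# < e ⊎ e < 0#
      decide (inj₁ 0<e) _          = inj₁ 0<e
      decide (inj₂ _)   (inj₂ e<0) = inj₂ e<0
      decide (inj₂ e<ε) (inj₁ -ε<e) = contradiction
        (<-trans (gap-bound (ℕₚ.m≤n⇒m≤1+n (ℕₚ.m≤m+n M _)) (rational-gap m k p (≈⇒≤ mε≈) (<⇒≤ e<ε)
          (≤-respʳ (solve 1 (λ ε → :- :- ε := ε) refl ε) (≤-neg (<⇒≤ -ε<e))))) bound<2)
        (by-nonneg (*-nonneg (<⇒≤ (*-positive (0<suc 1) 0<w)) (nonneg 4q≤m+1))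
          (sym (trans (solve 3 (λ w m q → con (+ 2) :* w :* (m :- con (+ 4) :* q) := m :* (con (+ 2) :* w) :- con (+ 2) :* (con (+ 4) :* q :* w)) refl w ⌜ suc m ⌝ q)
            (+-congˡ (-‿cong (trans (*-congˡ (x*inv≈1 _ 0<4q)) (*-identityʳ _)))))))

    -- 11 u ≤ q u ≤ 1, so that (2q + q′ - 1) u ≥ 2 - u ≥ 21/11 > bound.
    quotient<2 : ∀ {x} (basis : Basis θ x) → M ℕ.≤ Basis.r basis → 10 ℕ.≤ Basis.r basis → ¬ (2 · 1# < x)
    quotient<2 {x} basis M≤r 10≤r 2<x = absurd
      (+-pos-nonneg (+-pos-nonneg (+-pos-nonneg
        (+-positive (pos (*-monoˡ-< (0<suc 10) 2q<bound)) (pos 11*bound<21))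
        (*-nonneg (⌜⌝-nonneg 11) (*-nonneg (⌜⌝-nonneg q′) (nonneg 2v≤u))))
        (*-nonneg (nonneg (⌜⌝-mono-≤ (s≤s 10≤r))) (<⇒≤ 0<u)))
        (*-nonneg (⌜⌝-nonneg q′) (<⇒≤ 0<v)))
      (trans (solve 5 (λ q Q u v b →
          con (+ 11) :* b :- con (+ 11) :* ((con (+ 2) :* q :+ Q :- con 1ℤ) :* u) :+ (con (+ 21) :- con (+ 11) :* b)
            :+ con (+ 11) :* (Q :* (u :- con (+ 2) :* v)) :+ (q :- con (+ 11)) :* u :+ Q :* v
          := con (+ 21) :* (con 1ℤ :- (q :* u :+ Q :* v))) refl q Q′ u v bound)
        (trans (*-congˡ (diff≈0 (sym q*u+Q′*v≈1))) (solve 0 (con (+ 21) :* con 0ℤ := con 0ℤ) refl)))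
      where
      open BasisProperties basis
      2v≤u : 2 · 1# * v ≤ u
      2v≤u = <⇒≤ (by-pos (*-positive (pos 2<x) 0<v) (trans (+-congʳ ratio)
        (solve 2 (λ x v → x :* v :- con (+ 2) :* v := (x :- con (+ 2)) :* v) refl x v)))
      2q<bound : (2 · 1# * q + Q′ - 1#) * u < bound
      2q<bound = <-respˡ-≈ (*-congʳ (trans (+-congˡ (trans (⌜⌝-+ (r ℕ.+ r) q′) (+-congʳ (⌜⌝-+ r r))))
          (solve 2 (λ r Q → con 1ℤ :+ (r :+ r :+ Q) := con (+ 2) :* (con 1ℤ :+ r) :+ Q :- con 1ℤ) refl ⌜ r ⌝ Q′)))
        (gap-bound (ℕₚ.≤-trans M≤r (ℕₚ.≤-trans (ℕₚ.m≤m+n r r) (ℕₚ.m≤m+n (r ℕ.+ r) q′))) (gap-u ℕₚ.≤-refl))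

    module _ (irr : Irrational θ) where

      quotient≡1 : (s : State θ) → M ℕ.+ 10 ℕ.≤ Basis.r (proj₂ (proj₂ s)) → proj₁ (quotient-of irr s) ≡ 0
      quotient≡1 s large = zero-below (proj₁ (quotient-of irr s)) (proj₁ (proj₂ (quotient-of irr s)))
        where
        zero-below : ∀ a → ⌜ suc a ⌝ < proj₁ s → a ≡ 0
        zero-below zero    _  = ≡.refl
        zero-below (suc a) <x = contradiction (≤-<-trans (⌜⌝-mono-≤ {2} {2 ℕ.+ a} (s≤s (s≤s z≤n))) <x)
          (quotient<2 (proj₂ (proj₂ s)) (ℕₚ.≤-trans (ℕₚ.m≤m+n M 10) large) (ℕₚ.≤-trans (ℕₚ.m≤n+m 10 M) large))

      eventually-1 : ∀ i → a₁₊ irr (suc (M ℕ.+ 10 ℕ.+ i)) ≡ 0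
      eventually-1 i = quotient≡1 (state irr (suc (M ℕ.+ 10 ℕ.+ i)))
        (ℕₚ.≤-trans (ℕₚ.m≤m+n (M ℕ.+ 10) i) (r-grows irr (M ℕ.+ 10 ℕ.+ i)))

    ones : ContinuedFraction
    ones = record { quotient = λ _ → 1ℤ ; positive = λ _ → ℤ.+<+ (s≤s z≤n) }

    φ-expansion : φ HasExpansion ones
    φ-expansion = has-expansion ones (λ _ → φ) (λ _ → 1<φ) (λ _ → [φ-1]x≈1) [φ-1]x≈1

    small-gaps⇒golden : θ ≍ φ
    small-gaps⇒golden = expansion irrational , ones , θ-expansion irrational , φ-expansion ,
        -- Two beyond `M + 10`: one for the integer part, one because `r-grows` gives `i ≤ r` at the
        -- basis of index `i + 1`. The term 10 ensures `q ≥ 11`.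
        suc (suc (M ℕ.+ 10)) , 1 , s≤s z≤n , s≤s z≤n , λ i → ≡.cong +[1+_] (eventually-1 irrational i)

mainTheorem1 : ∀ {c ℓ₁ ℓ₂} (R : Reals c ℓ₁ ℓ₂) → let open RealTheory R in
    (√5 : ℝ) (0<√5 : 0# < √5) → √5 * √5 ≈ 5 · 1# →
    (θ : ℝ) →
    (∃[ M ] 0 ℕ.< M × (∀ m → M ℕ.≤ m →
    ∃[ d ] IsLargestGap θ m d × suc m · d < 1# + (2 · 1#) * inv √5 0<√5))
    ⇔ θ ≍ goldenRatio √5
mainTheorem1 R √5 0<√5 √5²≈5 θ = mk⇔
  (λ (M , _ , small) → Converse.small-gaps⇒golden R √5 0<√5 √5²≈5 small)
  (Golden.golden⇒small-gaps R √5 0<√5 √5²≈5)
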